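{- Let $M=2s+3$ with $s\ge1$, $q$ a power of $2$. Let $K$ be a complete $k$-arc in $PG(2,q)$ with exactly one sum-point, such that $K\cap l_\infty=\{(0,0,1),(0,1,0)\}$, $(k-2)p(K)<q-1$, and $K\cap\{(1,a,Aa^2):A\in S_1(K),a\in\mathbb{F}_q\}=\emptyset$. For $j=0,\dots,s-1$ let $\Phi_j:PG(2j+2,q)\to PG(2s+2,q)$, $\Phi_j(Y_0,\dots,Y_{2j+2})=(0,\dots,0,Y_0,Y_0,Y_1,\dots,Y_{2j+2})$ ($2s-2j-1$ leading zeros), $K^{(0)}=\Phi_0(K)$, $K^{(j)}=\Phi_j((K:\mathcal{P}^j))$ for $1\le j\le s-1$, and $\mathcal{X}=(K:\mathcal{P}^s)\cup\bigcup_{j=0}^{s-1}K^{(j)}\subset PG(2s+2,q)$. Let $\bar{\mathcal{X}}'$ be the image of $\mathcal{X}$ under $(x_0,\dots,x_{2s+2})\mapsto(0,x_0,\dots,x_{2s+2})$ in $PG(2s+3,q)$, and $K_0=\{(1,1),(1,0)\}\subset PG(1,q)$. Then $(K_0:\mathcal{P}^{s+1})\cup\bar{\mathcal{X}}'$ is a complete cap in $PG(2s+3,q)$ of size $$2q^{\frac{M-1}{2}}+k\left(q^{\frac{M-3}{2}}+q^{\frac{M-5}{2}}+\dots+q+1\right).$$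
   Context: A cap in $PG(N,q)$ is a set of points no three collinear; complete if not contained in a larger cap; an arc is a cap in $PG(2,q)$. In $PG(2,q)$, $l_\infty$ is the line $X_0=0$. A point is in normalized form if its first nonzero coordinate is $1$. Sum-point: for a complete arc $K$ and $Q\notin K$ in normalized form, for each secant $l$ of $K$ through $Q$ write $Q=c_1^{(l)}P_1+c_2^{(l)}P_2$ with $P_1,P_2$ the points of $l\cap K$ in normalized form; $Q$ is a sum-point if $c_1^{(l)}=c_2^{(l)}$ for all such $l$. If $K$ has exactly one sum-point, $p(K)$ is the number of secants of $K$ through it. $S_1(K)=\{X_1+Y_1:(X_0,X_1,X_2),(Y_0,Y_1,Y_2)\in K$ in normalized form, $X_0=Y_0,X_1\ne Y_1,X_2+Y_2=X_1+Y_1\}$. $\mathcal{P}^j=\{(a_1,a_1^2,\dots,a_j,a_j^2):a_i\in\mathbb{F}_q\}$. For points $C\subset PG(n,q)$ and $C'\subset\mathbb{F}_q^m$, $(C:C')=\{(x_0,\dots,x_n,y_1,\dots,y_m):(x_0,\dots,x_n)$ normalized form of a point of $C$, $(y_i)\in C'\}\subset PG(n+m,q)$. -}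

module Defs where

open import Level using (0ℓ)
open import Data.Nat as ℕ using (ℕ; zero; suc; _<_; _∸_; _^_)
open import Data.Product using (Σ; ∃; _×_; _,_)
open import Data.Sum using (_⊎_)
open import Data.Empty using (⊥)
open import Data.Unit using (⊤)
open import Data.List using (List; length)
open import Data.List.Membership.Propositional using (_∈_)
open import Data.List.Relation.Unary.Unique.Propositional using (Unique)
open import Data.Vec using (Vec; []; _∷_; _++_; replicate; cast; zipWith; map)
open import Relation.Nullary using (¬_; Dec)
open import Relation.Binary.PropositionalEquality using (_≡_; _≢_; refl; cong)
open import Algebra.Structures using (IsCommutativeRing)
open import Function.Bundles using (_⇔_)
open import Data.Nat.Solver using (module +-*-Solver)

record FiniteField : Set₁ where
  infixl 6 _+_
  infixl 7 _*_
  field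
    Carrier  : Set
    _+_ _*_  : Carrier → Carrier → Carrier
    -_       : Carrier → Carrier
    0# 1#    : Carrier
    isCommutativeRing : IsCommutativeRing _≡_ _+_ _*_ -_ 0# 1#
    0≢1      : 0# ≢ 1#
    inverse  : ∀ x → x ≢ 0# → ∃ λ y → x * y ≡ 1#
    _≟_      : (x y : Carrier) → Dec (x ≡ y)
    elements : List Carrier
    complete : ∀ x → x ∈ elements
    unique   : Unique elements

  order : ℕ
  order = length elements

IsPowerOf2 : ℕ → Set
IsPowerOf2 q = ∃ λ m → q ≡ 2 ^ m

geomSum : ℕ → ℕ → ℕ
geomSum q zero    = 1
geomSum q (suc s) = q ^ suc s ℕ.+ geomSum q s

-- length identity used for Φ_j (s = j + 1 + t, so 2s-2j-1 = 2t+1 zeros)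
Φ-len : ∀ j t s → j ℕ.+ suc t ≡ s →
        suc (t ℕ.* 2) ℕ.+ suc (3 ℕ.+ j ℕ.* 2) ≡ 3 ℕ.+ s ℕ.* 2
Φ-len j t .(j ℕ.+ suc t) refl = solve 2 (λ j t → (con 1 :+ t :* con 2) :+ (con 4 :+ j :* con 2)
                                        := con 3 :+ (j :+ (con 1 :+ t)) :* con 2) refl j t
  where open +-*-Solver

-- Projective geometry over a finite field F.
-- A point of PG(n,q) is represented by its normalized form: a vector in
-- F^(n+1) whose first nonzero coordinate is 1.  A point set of PG(n,q)
-- is a predicate on such vectors (only normalized vectors matter).

module Geometry (𝔽 : FiniteField) where
  open FiniteField 𝔽 public

  q : ℕ
  q = order

  Normalized : ∀ {n} → Vec Carrier n → Set
  Normalized []      = ⊥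
  Normalized (x ∷ v) = (x ≡ 0# × Normalized v) ⊎ x ≡ 1#

  PointSet : ℕ → Set₁
  PointSet n = Vec Carrier (suc n) → Set

  _⊕_ : ∀ {n} → Vec Carrier n → Vec Carrier n → Vec Carrier n
  _⊕_ = zipWith _+_

  _•_ : ∀ {n} → Carrier → Vec Carrier n → Vec Carrier n
  c • v = map (c *_) v

  zeros : ∀ {n} → Vec Carrier n
  zeros {n} = replicate n 0#

  Collinear : ∀ {n} → (P Q R : Vec Carrier n) → Set
  Collinear P Q R = ∃ λ a → ∃ λ b → ∃ λ c →
    ¬ (a ≡ 0# × b ≡ 0# × c ≡ 0#) × ((a • P) ⊕ (b • Q)) ⊕ (c • R) ≡ zeros

  Cap : ∀ {n} → PointSet n → Set
  Cap S = ∀ P Q R → Normalized P → Normalized Q → Normalized R →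
          S P → S Q → S R → P ≢ Q → Q ≢ R → P ≢ R → ¬ Collinear P Q R

  _∪_ : ∀ {n} → PointSet n → PointSet n → PointSet n
  (S ∪ T) v = S v ⊎ T v

  insert : ∀ {n} → Vec Carrier (suc n) → PointSet n → PointSet n
  insert Q S v = S v ⊎ v ≡ Q

  CompleteCap : ∀ {n} → PointSet n → Set
  CompleteCap S = Cap S × (∀ Q → Normalized Q → ¬ S Q → ¬ Cap (insert Q S))

  HasSize : ∀ {n} → PointSet n → ℕ → Set
  HasSize S k = Σ (List (Vec Carrier _)) λ l →
    Unique l × (∀ v → (v ∈ l) ⇔ (Normalized v × S v)) × length l ≡ k

  Arc : PointSet 2 → Set
  Arc = Cap

  CompleteArc : PointSet 2 → Set
  CompleteArc = CompleteCap

  IsSumPoint : PointSet 2 → Vec Carrier 3 → Set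
  IsSumPoint K Q = Normalized Q × ¬ K Q ×
    (∀ P₁ P₂ → Normalized P₁ → Normalized P₂ → K P₁ → K P₂ → P₁ ≢ P₂ →
      ∀ c₁ c₂ → Q ≡ (c₁ • P₁) ⊕ (c₂ • P₂) → c₁ ≡ c₂)

  -- number of secants of K through Q is p: there are exactly 2p ordered
  -- pairs (P₁,P₂) of distinct points of K with Q on the line P₁P₂
  -- (each secant of an arc meets it in exactly two points)
  SecantCount : PointSet 2 → Vec Carrier 3 → ℕ → Set
  SecantCount K Q p = Σ (List (Vec Carrier 3 × Vec Carrier 3)) λ l →
    Unique l ×
    (∀ P₁ P₂ → ((P₁ , P₂) ∈ l) ⇔
       (Normalized P₁ × Normalized P₂ × K P₁ × K P₂ × P₁ ≢ P₂ × Collinear P₁ P₂ Q)) ×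
    length l ≡ 2 ℕ.* p

  S₁ : PointSet 2 → Carrier → Set
  S₁ K A = ∃ λ x₀ → ∃ λ x₁ → ∃ λ x₂ → ∃ λ y₀ → ∃ λ y₁ → ∃ λ y₂ →
    Normalized (x₀ ∷ x₁ ∷ x₂ ∷ []) × Normalized (y₀ ∷ y₁ ∷ y₂ ∷ []) ×
    K (x₀ ∷ x₁ ∷ x₂ ∷ []) × K (y₀ ∷ y₁ ∷ y₂ ∷ []) ×
    x₀ ≡ y₀ × x₁ ≢ y₁ × x₂ + y₂ ≡ x₁ + y₁ × A ≡ x₁ + y₁

  𝒫 : (j : ℕ) → Vec Carrier (j ℕ.* 2) → Set
  𝒫 zero    []            = ⊤
  𝒫 (suc j) (a ∷ b ∷ v)   = b ≡ a * a × 𝒫 j v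

  _∶_ : ∀ {n m} → PointSet n → (Vec Carrier m → Set) → PointSet (n ℕ.+ m)
  (C ∶ C') v = ∃ λ x → ∃ λ y → Normalized x × C x × C' y × v ≡ x ++ y

  -- Φ_j : PG(2j+2,q) → PG(2s+2,q), for s = j + 1 + t  (2s-2j-1 = 2t+1 zeros)
  Φ : ∀ j t s → j ℕ.+ suc t ≡ s → Vec Carrier (3 ℕ.+ j ℕ.* 2) → Vec Carrier (3 ℕ.+ s ℕ.* 2)
  Φ j t s e (y₀ ∷ y) = cast (Φ-len j t s e) (replicate (suc (t ℕ.* 2)) 0# ++ (y₀ ∷ y₀ ∷ y))

  -- K^(j) = Φ_j((K : 𝒫^j))   (K^(0) = Φ_0(K) = Φ_0((K : 𝒫^0)))
  Kʲ : PointSet 2 → (s j : ℕ) → PointSet (2 ℕ.+ s ℕ.* 2)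
  Kʲ K s j v = ∃ λ t → Σ (j ℕ.+ suc t ≡ s) λ e →
               ∃ λ y → (K ∶ 𝒫 j) y × v ≡ Φ j t s e y

  𝒳 : PointSet 2 → (s : ℕ) → PointSet (2 ℕ.+ s ℕ.* 2)
  𝒳 K s v = (K ∶ 𝒫 s) v ⊎ (∃ λ j → j < s × Kʲ K s j v)

  𝒳̄′ : PointSet 2 → (s : ℕ) → PointSet (3 ℕ.+ s ℕ.* 2)
  𝒳̄′ K s v = ∃ λ x → 𝒳 K s x × v ≡ 0# ∷ x

  K₀ : PointSet 1
  K₀ v = v ≡ 1# ∷ 1# ∷ [] ⊎ v ≡ 1# ∷ 0# ∷ []

  MeetsLineAtInfinityIn₂ : PointSet 2 → Set
  MeetsLineAtInfinityIn₂ K = ∀ P → Normalized P →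
    (K P × Data.Vec.head P ≡ 0#) ⇔ (P ≡ 0# ∷ 0# ∷ 1# ∷ [] ⊎ P ≡ 0# ∷ 1# ∷ 0# ∷ [])

{-# OPTIONS --safe #-}
module Submission where

-- Since q is a power of 2, the field has characteristic 2 and squaring is bijective.  The sum-point of K is
-- (0,1,1), and every point of 𝒳 below the top level starts with a multiple of it, so 𝒳 can be treated by
-- induction on s.
--
-- Cap: on three dependent points with equal beginnings the coefficients sum to 0, and the parabola
-- coordinates then coincide.  A dependency that mixes levels, or mixes points with x₀ = 1 and x₀ = 0, has
-- two points P, P′ with equal coefficients; by additivity of squaring the third point has parabola
-- coordinates μ (u, u²), and so yields a point (1, a, A a²) of K with A ∈ S₁(K) (a secant of K through
-- (0,1,1)) or a point (0, μ u, μ u²) of K, neither of which exists.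
--
-- Completeness: for distinct nonzero α, β the map (a, a′) ↦ (α a + β a′, α a² + β a′²) is onto, so a secant
-- of K with c₁ ≠ c₂ through the first three coordinates of a point extends to a secant through the point.
-- Beginnings in K are handled by α + β = 1 with α ∉ {0,1}, which exists because (k - 2) p(K) < q - 1 forces
-- q > 2.  A beginning (0,1,1) is passed to the next lower level, where it becomes the affine coordinate 1;
-- at the last level the point is the sum of two points of (K₀ : 𝒫^(s+1)).

open import Defs
open import Algebra.Bundles using (CommutativeRing)
import Algebra.Properties.Group as GroupProperties
import Algebra.Properties.Semiring.Mult as SemiringMult
import Algebra.Solver.Ring as RingSolver
open import Algebra.Solver.Ring.AlmostCommutativeRing using (AlmostCommutativeRing; fromCommutativeSemiring; _-Raw-AlmostCommutative⟶_)
open import Data.Bool using (Bool; true; false)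
import Data.Bool.Properties as Bool
open import Data.Empty using (⊥; ⊥-elim)
open import Data.List as List using (List; length; cartesianProductWith; foldr)
open import Data.List.Membership.Propositional using (_∈_; find)
open import Data.List.Membership.Propositional.Properties using (∈-++⁻; ∈-++⁺ˡ; ∈-++⁺ʳ; ∈-∃++; ∈-map⁺; ∈-map⁻; ∈-cartesianProductWith⁺; ∈-cartesianProductWith⁻)
open import Data.List.Membership.Propositional.Properties.WithK using (unique∧set⇒bag)
open import Data.List.Properties using (length-++; length-map)
open import Data.List.Relation.Binary.BagAndSetEquality using (∼bag⇒↭)
open import Data.List.Relation.Binary.Disjoint.Propositional using (Disjoint)
open import Data.List.Relation.Binary.Permutation.Propositional using (_↭_; ↭⇒↭ₛ)
open import Data.List.Relation.Binary.Permutation.Setoid.Properties using (foldr-commMonoid)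
open import Data.List.Relation.Binary.Subset.Propositional using (_⊆_)
import Data.List.Relation.Unary.All as All
import Data.List.Relation.Unary.AllPairs as AllPairs
open import Data.List.Relation.Unary.Any as Any using (here; there; any?)
open import Data.List.Relation.Unary.Unique.Propositional using (Unique)
import Data.List.Relation.Unary.Unique.Propositional.Properties as Uniq
open import Data.Maybe using (Maybe; just; nothing)
open import Data.Nat as ℕ using (ℕ; zero; suc; _≤_; _<_; _∸_; _^_; z≤n; s≤s)
import Data.Nat.Properties as ℕ
open import Data.Product using (∃; ∃₂; _×_; _,_; proj₁; proj₂)
open import Data.Sum using (_⊎_; inj₁; inj₂)
open import Data.Unit using (⊤; tt)
open import Data.Vec using (Vec; _∷_; []; _++_; head)
import Data.Vec.Properties as Vec
open import Function using (_∘_)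
open import Function.Bundles using (mk⇔; Equivalence)
open import Relation.Binary.PropositionalEquality using (_≡_; _≢_; refl; sym; trans; cong; cong₂; subst; setoid; module ≡-Reasoning)
open import Relation.Nullary using (¬_; Dec; yes; no; contradiction)
open import Relation.Nullary.Decidable using (¬?; _×-dec_; decidable-stable; map′)

-- Counting with lists without repetitions.

unique-⊆⇒length≤ : ∀ {A : Set} {xs ys : List A} → Unique xs → xs ⊆ ys → length xs ≤ length ys
unique-⊆⇒length≤ {xs = List.[]} _ _ = z≤n
unique-⊆⇒length≤ {xs = x List.∷ xs} (x∉xs AllPairs.∷ xs!) xs⊆ys with ∈-∃++ (xs⊆ys (here refl))
... | as , bs , refl = begin
  suc (length xs)                     ≤⟨ s≤s (unique-⊆⇒length≤ xs! xs⊆as++bs) ⟩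
  suc (length (as List.++ bs))        ≡⟨ cong suc (length-++ as) ⟩
  suc (length as ℕ.+ length bs)       ≡⟨ ℕ.+-suc _ _ ⟨
  length as ℕ.+ suc (length bs)       ≡⟨ length-++ as ⟨
  length (as List.++ x List.∷ bs)     ∎
  where
  open ℕ.≤-Reasoning
  xs⊆as++bs : xs ⊆ as List.++ bs
  xs⊆as++bs z∈xs with ∈-++⁻ as (xs⊆ys (there z∈xs))
  ... | inj₁ z∈as         = ∈-++⁺ˡ z∈as
  ... | inj₂ (here refl)  = contradiction refl (All.lookup x∉xs z∈xs)
  ... | inj₂ (there z∈bs) = ∈-++⁺ʳ as z∈bs

length-cartesianProductWith : ∀ {A B C : Set} (f : A → B → C) xs ys →
  length (cartesianProductWith f xs ys) ≡ length xs ℕ.* length ys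
length-cartesianProductWith f List.[] ys = refl
length-cartesianProductWith f (x List.∷ xs) ys = trans (length-++ (List.map (f x) ys))
  (cong₂ ℕ._+_ (length-map (f x) ys) (length-cartesianProductWith f xs ys))

-- Finite fields whose order is a power of 2.

HasCharacteristic2 : FiniteField → Set
HasCharacteristic2 𝔽 = 1# + 1# ≡ 0#
  where open FiniteField 𝔽

module FieldProperties (𝔽 : FiniteField) where
  open FiniteField 𝔽

  commutativeRing : CommutativeRing _ _
  commutativeRing = record { isCommutativeRing = isCommutativeRing }

  open CommutativeRing commutativeRing public
    using (+-assoc; +-comm; +-identityˡ; +-identityʳ; *-assoc; *-comm; *-identityˡ; *-identityʳ; zeroˡ; zeroʳ; distribˡ; distribʳ)
  private module CR = CommutativeRing commutativeRing

  *-cancelˡ-0 : ∀ {x y} → x ≢ 0# → x * y ≡ 0# → y ≡ 0#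
  *-cancelˡ-0 {x} {y} x≢0 xy≡0 with inverse x x≢0
  ... | x⁻¹ , xx⁻¹≡1 = begin
    y               ≡⟨ *-identityˡ y ⟨
    1# * y          ≡⟨ cong (_* y) (trans (*-comm x⁻¹ x) xx⁻¹≡1) ⟨
    x⁻¹ * x * y     ≡⟨ *-assoc x⁻¹ x y ⟩
    x⁻¹ * (x * y)   ≡⟨ cong (x⁻¹ *_) xy≡0 ⟩
    x⁻¹ * 0#        ≡⟨ zeroʳ x⁻¹ ⟩
    0#              ∎
    where open ≡-Reasoning

  *-nonzero : ∀ {x y} → x ≢ 0# → y ≢ 0# → x * y ≢ 0#
  *-nonzero x≢0 y≢0 xy≡0 = y≢0 (*-cancelˡ-0 x≢0 xy≡0)

  open SemiringMult CR.semiring using (×1-homo-*) renaming (_×_ to _×′_)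

  private
    sum : List Carrier → Carrier
    sum = foldr _+_ 0#

    sum-map-+1 : ∀ xs → sum (List.map (_+ 1#) xs) ≡ sum xs + length xs ×′ 1#
    sum-map-+1 List.[] = sym (+-identityʳ 0#)
    sum-map-+1 (x List.∷ xs) = begin
      x + 1# + sum (List.map (_+ 1#) xs)      ≡⟨ cong (x + 1# +_) (sum-map-+1 xs) ⟩
      x + 1# + (sum xs + length xs ×′ 1#)     ≡⟨ interchange x 1# (sum xs) _ ⟩
      x + sum xs + (1# + length xs ×′ 1#)     ∎
      where
      open ≡-Reasoning
      open import Algebra.Properties.CommutativeSemigroup CR.+-commutativeSemigroup using (interchange)

    +1-injective : ∀ {x y} → x + 1# ≡ y + 1# → x ≡ y
    +1-injective = GroupProperties.∙-cancelʳ CR.+-group 1# _ _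

    -- Two lists without repetitions that have the same members are permutations of each other, and
    -- every x is the translate of x - 1.
    translate-↭ : List.map (_+ 1#) elements ↭ elements
    translate-↭ = ∼bag⇒↭ (unique∧set⇒bag (Uniq.map⁺ +1-injective unique) unique
      (mk⇔ (λ _ → complete _) (λ _ → ∈-shift _)))
      where
      ∈-shift : ∀ x → x ∈ List.map (_+ 1#) elements
      ∈-shift x = subst (_∈ List.map (_+ 1#) elements)
        (trans (+-assoc x (- 1#) 1#) (trans (cong (x +_) (CR.-‿inverseˡ 1#)) (+-identityʳ x)))
        (∈-map⁺ (_+ 1#) (complete (x + - 1#)))

  -- Translation by 1 permutes the field, so the sum of all elements changes by order × 1 and yet stays the same.
  order×1≡0 : order ×′ 1# ≡ 0#
  order×1≡0 = GroupProperties.∙-cancelˡ CR.+-group (sum elements) _ _ (begin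
    sum elements + order ×′ 1#         ≡⟨ sum-map-+1 elements ⟨
    sum (List.map (_+ 1#) elements)    ≡⟨ foldr-commMonoid (setoid Carrier) CR.+-isCommutativeMonoid (↭⇒↭ₛ translate-↭) ⟩
    sum elements                       ≡⟨ +-identityʳ _ ⟨
    sum elements + 0#                  ∎)
    where open ≡-Reasoning

  -- The order as a field element is a product of m factors 1 + 1 and vanishes. If 1 + 1 were
  -- nonzero, all the factors could be cancelled, which would leave 1 = 0.
  characteristic-2 : IsPowerOf2 order → HasCharacteristic2 𝔽
  characteristic-2 (m , order≡2^m) = descend m (subst (λ n → n ×′ 1# ≡ 0#) order≡2^m order×1≡0)
    where
    descend : ∀ m → (2 ^ m) ×′ 1# ≡ 0# → 1# + 1# ≡ 0#
    descend zero    1×1≡0 = contradiction (sym (trans (sym (+-identityʳ 1#)) 1×1≡0)) 0≢1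
    descend (suc m) eq with (1# + 1#) ≟ 0#
    ... | yes 1+1≡0 = 1+1≡0
    ... | no  1+1≢0 = descend m (*-cancelˡ-0 (1+1≢0 ∘ trans (cong (1# +_) (sym (+-identityʳ 1#))))
                        (trans (sym (×1-homo-* 2 (2 ^ m))) eq))

module Characteristic2 (𝔽 : FiniteField) (1+1≡0 : HasCharacteristic2 𝔽) where
  open FiniteField 𝔽
  open FieldProperties 𝔽 public

  -- In characteristic 2 the ring solver may compute with coefficients in the two-element field.
  private
    R : AlmostCommutativeRing _ _
    R = fromCommutativeSemiring (CommutativeRing.commutativeSemiring commutativeRing)

    ⟦_⟧ : Bool → Carrier
    ⟦ false ⟧ = 0#
    ⟦ true  ⟧ = 1#

    open CommutativeRing Bool.xor-∧-commutativeRing using () renaming (rawRing to 𝔽₂)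

    𝔽₂⟶R : 𝔽₂ -Raw-AlmostCommutative⟶ R
    𝔽₂⟶R = record
      { ⟦_⟧    = ⟦_⟧
      ; +-homo = λ { false y → sym (+-identityˡ ⟦ y ⟧) ; true false → sym (+-identityʳ 1#) ; true true → sym 1+1≡0 }
      ; *-homo = λ { false y → sym (zeroˡ ⟦ y ⟧) ; true y → sym (*-identityˡ ⟦ y ⟧) }
      ; -‿homo = λ _ → refl
      ; 0-homo = refl
      ; 1-homo = refl
      }

    _≟₂_ : (b c : Bool) → Maybe (⟦ b ⟧ ≡ ⟦ c ⟧)
    false ≟₂ false = just refl
    true  ≟₂ true  = just refl
    _     ≟₂ _     = nothing

  open RingSolver 𝔽₂ R 𝔽₂⟶R _≟₂_ public
    using (solve; _:=_; _:+_; _:*_; con)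

  +≡0⇒≡ : ∀ {x y} → x + y ≡ 0# → x ≡ y
  +≡0⇒≡ {x} {y} eq = trans (solve 2 (λ x y → x := x :+ y :+ y) refl x y)
    (trans (cong (_+ y) eq) (+-identityˡ y))

  x+x≡0 : ∀ x → x + x ≡ 0#
  x+x≡0 = solve 1 (λ x → x :+ x := con false) refl

  *-cancelˡ : ∀ {a x y} → a ≢ 0# → a * x ≡ a * y → x ≡ y
  *-cancelˡ {a} {x} {y} a≢0 eq = +≡0⇒≡ (*-cancelˡ-0 a≢0
    (trans (distribˡ a x y) (trans (cong (_+ a * y) eq) (x+x≡0 (a * y)))))

  -- In characteristic 2, x² + y² = (x + y)², and a nonzero element has a nonzero square.
  square-injective : ∀ {x y} → x * x ≡ y * y → x ≡ y
  square-injective {x} {y} eq with (x + y) ≟ 0#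
  ... | yes x+y≡0 = +≡0⇒≡ x+y≡0
  ... | no  x+y≢0 = contradiction
    (trans (solve 2 (λ x y → (x :+ y) :* (x :+ y) := x :* x :+ y :* y) refl x y)
      (trans (cong (_+ y * y) eq) (x+x≡0 (y * y))))
    (*-nonzero x+y≢0 x+y≢0)

  -- An injective self-map of a finite set is onto: if x were no square, then x and the q distinct
  -- squares would be q + 1 distinct field elements.
  sqrt : ∀ x → ∃ λ y → y * y ≡ x
  sqrt x with any? (λ y → (y * y) ≟ x) elements
  ... | yes p = let y , _ , eq = find p in y , eq
  ... | no ¬p = contradiction
    (unique-⊆⇒length≤ (All.tabulate fresh AllPairs.∷ Uniq.map⁺ square-injective unique) (λ _ → complete _))
    (ℕ.<⇒≱ (s≤s (ℕ.≤-reflexive (sym (length-map (λ y → y * y) elements)))))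
    where
    fresh : ∀ {z} → z ∈ List.map (λ y → y * y) elements → x ≢ z
    fresh z∈ refl with ∈-map⁻ (λ y → y * y) z∈
    ... | y , y∈ , x≡yy = ¬p (Any.map (λ { refl → sym x≡yy }) y∈)

-- Linear dependence of normalized vectors, and products of parabolas.

module LinearDependence (𝔽 : FiniteField) (1+1≡0 : HasCharacteristic2 𝔽) where
  open Geometry 𝔽
  open Characteristic2 𝔽 1+1≡0 public

  -- The relations are stated coordinate by coordinate, so that matching yields one scalar equation
  -- at a time and the first coordinates separate from the parabola coordinates.
  Dep₂ : ∀ {n} → Carrier → Carrier → Vec Carrier n → Vec Carrier n → Set
  Dep₂ a b []      []      = ⊤
  Dep₂ a b (x ∷ P) (y ∷ Q) = a * x + b * y ≡ 0# × Dep₂ a b P Q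

  Dep₃ : ∀ {n} → Carrier → Carrier → Carrier → Vec Carrier n → Vec Carrier n → Vec Carrier n → Set
  Dep₃ a b c []      []      []      = ⊤
  Dep₃ a b c (x ∷ P) (y ∷ Q) (z ∷ R) = a * x + b * y + c * z ≡ 0# × Dep₃ a b c P Q R

  Comb : ∀ {n} → Carrier → Carrier → Vec Carrier n → Vec Carrier n → Vec Carrier n → Set
  Comb α β []      []      []      = ⊤
  Comb α β (x ∷ Q) (y ∷ P) (z ∷ R) = x ≡ α * y + β * z × Comb α β Q P R

  ≡zeros⇒Dep₃ : ∀ {n a b c} (P Q R : Vec Carrier n) →
    ((a • P) ⊕ (b • Q)) ⊕ (c • R) ≡ zeros → Dep₃ a b c P Q R
  ≡zeros⇒Dep₃ []      []      []      _  = tt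
  ≡zeros⇒Dep₃ (x ∷ P) (y ∷ Q) (z ∷ R) eq =
    let eq₁ , eq₂ = Vec.∷-injective eq in eq₁ , ≡zeros⇒Dep₃ P Q R eq₂

  Dep₃⇒≡zeros : ∀ {n a b c} (P Q R : Vec Carrier n) →
    Dep₃ a b c P Q R → ((a • P) ⊕ (b • Q)) ⊕ (c • R) ≡ zeros
  Dep₃⇒≡zeros []      []      []      _          = refl
  Dep₃⇒≡zeros (x ∷ P) (y ∷ Q) (z ∷ R) (eq , dep) = cong₂ _∷_ eq (Dep₃⇒≡zeros P Q R dep)

  ≡⇒Comb : ∀ {n α β} (Q P R : Vec Carrier n) → Q ≡ (α • P) ⊕ (β • R) → Comb α β Q P R
  ≡⇒Comb []      []      []      _  = tt
  ≡⇒Comb (x ∷ Q) (y ∷ P) (z ∷ R) eq =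
    let eq₁ , eq₂ = Vec.∷-injective eq in eq₁ , ≡⇒Comb Q P R eq₂

  Dep₃-rotate : ∀ {n a b c} (P Q R : Vec Carrier n) → Dep₃ a b c P Q R → Dep₃ b c a Q R P
  Dep₃-rotate []      []      []      _ = tt
  Dep₃-rotate {a = a} {b} {c} (x ∷ P) (y ∷ Q) (z ∷ R) (eq , dep) =
    trans (solve 3 (λ u v w → v :+ w :+ u := u :+ v :+ w) refl (a * x) (b * y) (c * z)) eq ,
    Dep₃-rotate P Q R dep

  Dep₂-swap : ∀ {n a b} (P Q : Vec Carrier n) → Dep₂ a b P Q → Dep₂ b a Q P
  Dep₂-swap []      []      _          = tt
  Dep₂-swap (x ∷ P) (y ∷ Q) (eq , dep) = trans (+-comm _ _) eq , Dep₂-swap P Q dep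

  Dep₃-zero : ∀ {n b c} (P Q R : Vec Carrier n) → Dep₃ 0# b c P Q R → Dep₂ b c Q R
  Dep₃-zero []      []      []      _ = tt
  Dep₃-zero {b = b} {c} (x ∷ P) (y ∷ Q) (z ∷ R) (eq , dep) =
    trans (solve 5 (λ b c x y z → b :* y :+ c :* z := con false :* x :+ b :* y :+ c :* z) refl b c x y z) eq ,
    Dep₃-zero P Q R dep

  Dep₃-merge : ∀ {n a b c} (P R : Vec Carrier n) → Dep₃ a b c P P R → Dep₂ c (a + b) R P
  Dep₃-merge []      []      _ = tt
  Dep₃-merge {a = a} {b} {c} (x ∷ P) (z ∷ R) (eq , dep) =
    trans (solve 5 (λ a b c x z → c :* z :+ (a :+ b) :* x := a :* x :+ b :* x :+ c :* z) refl a b c x z) eq ,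
    Dep₃-merge P R dep

  Comb-merge : ∀ {n α β} (Q P : Vec Carrier n) → Comb α β Q P P → Dep₂ 1# (α + β) Q P
  Comb-merge []      []      _ = tt
  Comb-merge {α = α} {β} (x ∷ Q) (y ∷ P) (eq , comb) =
    trans (cong (λ t → 1# * t + (α + β) * y) eq)
      (solve 3 (λ α β y → con true :* (α :* y :+ β :* y) :+ (α :+ β) :* y := con false) refl α β y) ,
    Comb-merge Q P comb

  Comb⇒Dep₃ : ∀ {n α β} (Q P R : Vec Carrier n) → Comb α β Q P R → Dep₃ α β 1# P R Q
  Comb⇒Dep₃ []      []      []      _ = tt
  Comb⇒Dep₃ {α = α} {β} (x ∷ Q) (y ∷ P) (z ∷ R) (eq , comb) =
    trans (cong (λ t → α * y + β * z + 1# * t) eq)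
      (solve 2 (λ u v → u :+ v :+ con true :* (u :+ v) := con false) refl (α * y) (β * z)) ,
    Comb⇒Dep₃ Q P R comb

  Comb-same : ∀ {n α β} → α + β ≡ 1# → (P : Vec Carrier n) → Comb α β P P P
  Comb-same α+β≡1 [] = tt
  Comb-same {α = α} {β} α+β≡1 (x ∷ P) =
    trans (sym (*-identityˡ x)) (trans (cong (_* x) (sym α+β≡1)) (distribʳ x α β)) , Comb-same α+β≡1 P

  Comb-++ : ∀ {m n α β} (Q P R : Vec Carrier m) {Q′ P′ R′ : Vec Carrier n} →
    Comb α β Q P R → Comb α β Q′ P′ R′ → Comb α β (Q ++ Q′) (P ++ P′) (R ++ R′)
  Comb-++ []      []      []      _           comb′ = comb′
  Comb-++ (_ ∷ Q) (_ ∷ P) (_ ∷ R) (eq , comb) comb′ = eq , Comb-++ Q P R comb comb′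

  Comb-zeroˡ : ∀ {n β} (Q P R : Vec Carrier n) → Comb 0# β Q P R → Comb 0# β Q R R
  Comb-zeroˡ []      []      []      _ = tt
  Comb-zeroˡ {β = β} (x ∷ Q) (y ∷ P) (z ∷ R) (eq , comb) =
    trans eq (cong (_+ β * z) (trans (zeroˡ y) (sym (zeroˡ z)))) , Comb-zeroˡ Q P R comb

  Comb-swap : ∀ {n α β} (Q P R : Vec Carrier n) → Comb α β Q P R → Comb β α Q R P
  Comb-swap []      []      []      _           = tt
  Comb-swap (_ ∷ Q) (_ ∷ P) (_ ∷ R) (eq , comb) = trans eq (+-comm _ _) , Comb-swap Q P R comb

  Dep₂-same : ∀ {n a b} (P : Vec Carrier n) → Normalized P → Dep₂ a b P P → a + b ≡ 0#
  Dep₂-same (x ∷ P) (inj₁ (_ , nP)) (_ , dep) = Dep₂-same P nP dep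
  Dep₂-same {a = a} {b} (x ∷ P) (inj₂ refl) (eq , _) =
    trans (sym (cong₂ _+_ (*-identityʳ a) (*-identityʳ b))) eq

  Dep₂-zero : ∀ {n a} (P Q : Vec Carrier n) → Normalized P → Dep₂ a 0# P Q → a ≡ 0#
  Dep₂-zero (x ∷ P) (y ∷ Q) (inj₁ (_ , nP)) (_ , dep) = Dep₂-zero P Q nP dep
  Dep₂-zero {a = a} (x ∷ P) (y ∷ Q) (inj₂ refl) (eq , _) =
    trans (solve 2 (λ a y → a := a :* con true :+ con false :* y) refl a y) eq

  Dep₂-equal-coefficients : ∀ {n a} (P Q : Vec Carrier n) → a ≢ 0# → Dep₂ a a P Q → P ≡ Q
  Dep₂-equal-coefficients []      []      _   _ = refl
  Dep₂-equal-coefficients {a = a} (x ∷ P) (y ∷ Q) a≢0 (eq , dep) =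
    cong₂ _∷_ (+≡0⇒≡ (*-cancelˡ-0 a≢0 (trans (distribˡ a x y) eq))) (Dep₂-equal-coefficients P Q a≢0 dep)

  -- The leading ones must stand in the same place, since otherwise one coefficient vanishes and
  -- then a = 0. At that place the relation reads a + b = 0, so a = b and a can be cancelled.
  Dep₂⇒≡ : ∀ {n a b} (P Q : Vec Carrier n) → a ≢ 0# → Normalized P → Normalized Q → Dep₂ a b P Q → P ≡ Q
  Dep₂⇒≡ (x ∷ P) (y ∷ Q) a≢0 (inj₁ (refl , nP)) (inj₁ (refl , nQ)) (_ , dep) = cong (0# ∷_) (Dep₂⇒≡ P Q a≢0 nP nQ dep)
  Dep₂⇒≡ {a = a} {b} (x ∷ P) (y ∷ Q) a≢0 (inj₁ (refl , nP)) (inj₂ refl) (eq , dep)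
    with refl ← trans (solve 2 (λ a b → b := a :* con false :+ b :* con true) refl a b) eq
    = contradiction (Dep₂-zero P Q nP dep) a≢0
  Dep₂⇒≡ {a = a} {b} (x ∷ P) (y ∷ Q) a≢0 (inj₂ refl) (inj₁ (refl , nQ)) (eq , dep) =
    contradiction (trans (solve 2 (λ a b → a := a :* con true :+ b :* con false) refl a b) eq) a≢0
  Dep₂⇒≡ {a = a} {b} (x ∷ P) (y ∷ Q) a≢0 (inj₂ refl) (inj₂ refl) (eq , dep)
    with refl ← +≡0⇒≡ (trans (sym (cong₂ _+_ (*-identityʳ a) (*-identityʳ b))) eq)
    = cong (1# ∷_) (Dep₂-equal-coefficients P Q a≢0 dep)

  -- If a = 0, a nontrivial relation between Q and R alone remains, and normalized vectors so
  -- related are equal.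
  coefficient-nonzero : ∀ {n a b c} (P Q R : Vec Carrier n) → Normalized Q → Normalized R → Q ≢ R →
    ¬ (a ≡ 0# × b ≡ 0# × c ≡ 0#) → Dep₃ a b c P Q R → a ≢ 0#
  coefficient-nonzero {b = b} {c} P Q R nQ nR Q≢R ¬000 dep refl with b ≟ 0# | Dep₃-zero P Q R dep
  ... | no  b≢0 | dep′ = Q≢R (Dep₂⇒≡ Q R b≢0 nQ nR dep′)
  ... | yes b≡0 | dep′ = Q≢R (sym (Dep₂⇒≡ R Q (λ c≡0 → ¬000 (refl , b≡0 , c≡0)) nR nQ (Dep₂-swap Q R dep′)))

  -- Rotating the relation applies `coefficient-nonzero` to each of the three points, so collinear
  -- distinct points always give a relation with three nonzero coefficients.
  cap-from-Dep₃ : ∀ {n} (S : PointSet n) →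
    (∀ {a b c} P Q R → a ≢ 0# → b ≢ 0# → c ≢ 0# → S P → S Q → S R →
      P ≢ Q → Q ≢ R → P ≢ R → ¬ Dep₃ a b c P Q R) → Cap S
  cap-from-Dep₃ S indep P Q R nP nQ nR sP sQ sR P≢Q Q≢R P≢R (a , b , c , ¬000 , eq) =
    indep P Q R
      (coefficient-nonzero P Q R nQ nR Q≢R ¬000 dep)
      (coefficient-nonzero Q R P nR nP (P≢R ∘ sym) (λ (b≡0 , c≡0 , a≡0) → ¬000 (a≡0 , b≡0 , c≡0)) dep′)
      (coefficient-nonzero R P Q nP nQ P≢Q (λ (c≡0 , a≡0 , b≡0) → ¬000 (a≡0 , b≡0 , c≡0)) (Dep₃-rotate Q R P dep′))
      sP sQ sR P≢Q Q≢R P≢R dep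
    where
    dep  = ≡zeros⇒Dep₃ P Q R eq
    dep′ = Dep₃-rotate P Q R dep

  -- P ≢ R holds because otherwise Q would be a multiple of P, hence equal to P ∈ S.
  cap-insert⇒¬Comb : ∀ {n} {S : PointSet n} → (∀ v → S v → Normalized v) →
    ∀ Q → Normalized Q → ¬ S Q → Cap (insert Q S) →
    ∀ {α β} P R → S P → S R → ¬ Comb α β Q P R
  cap-insert⇒¬Comb {S = S} norm Q nQ ¬sQ cap {α} {β} P R sP sR comb =
    cap P R Q (norm P sP) (norm R sR) nQ (inj₁ sP) (inj₁ sR) (inj₂ refl)
      (λ { refl → ¬sQ (subst S (sym (Dep₂⇒≡ Q P (0≢1 ∘ sym) nQ (norm P sP) (Comb-merge Q P comb))) sP) })
      (λ { refl → ¬sQ sR }) (λ { refl → ¬sQ sP })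
      (α , β , 1# , (λ (_ , _ , 1≡0) → 0≢1 (sym 1≡0)) , Dep₃⇒≡zeros P R Q (Comb⇒Dep₃ Q P R comb))

  -- With α = g², β = h², c = f² the second equation is the square of g a + h a′ = f.
  parabola-solve : ∀ {α β} → α ≢ 0# → β ≢ 0# → α ≢ β → ∀ b c →
    ∃₂ λ a a′ → b ≡ α * a + β * a′ × c ≡ α * (a * a) + β * (a′ * a′)
  parabola-solve {α} {β} α≢0 β≢0 α≢β b c with sqrt α | sqrt β | sqrt c
  ... | g , refl | h , refl | f , refl
    with inverse g (λ { refl → α≢0 (zeroˡ 0#) }) | inverse h (λ { refl → β≢0 (zeroˡ 0#) })
       | inverse (g + h) (λ eq → α≢β (cong (λ t → t * t) (+≡0⇒≡ eq)))
  ... | g⁻¹ , gg⁻¹≡1 | h⁻¹ , hh⁻¹≡1 | m , [g+h]m≡1 = a , a′ , sym linear , sym square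
    where
    open ≡-Reasoning
    r r′ a a′ : Carrier
    -- Cramer's rule for g r + h r′ = b and r + r′ = f in the unknowns r = g a and r′ = h a′. The
    -- determinant is g + h, with inverse m.
    r  = (b + f * h) * m
    r′ = (b + f * g) * m
    a  = g⁻¹ * r
    a′ = h⁻¹ * r′
    ga≡r : g * a ≡ r
    ga≡r = trans (sym (*-assoc g g⁻¹ r)) (trans (cong (_* r) gg⁻¹≡1) (*-identityˡ r))
    ha′≡r′ : h * a′ ≡ r′
    ha′≡r′ = trans (sym (*-assoc h h⁻¹ r′)) (trans (cong (_* r′) hh⁻¹≡1) (*-identityˡ r′))
    linear : g * g * a + h * h * a′ ≡ b
    linear = begin
      g * g * a + h * h * a′        ≡⟨ cong₂ _+_ (*-assoc g g a) (*-assoc h h a′) ⟩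
      g * (g * a) + h * (h * a′)    ≡⟨ cong₂ (λ x y → g * x + h * y) ga≡r ha′≡r′ ⟩
      g * r + h * r′                ≡⟨ solve 5 (λ b f g h m → g :* ((b :+ f :* h) :* m) :+ h :* ((b :+ f :* g) :* m) := b :* ((g :+ h) :* m)) refl b f g h m ⟩
      b * ((g + h) * m)             ≡⟨ cong (b *_) [g+h]m≡1 ⟩
      b * 1#                        ≡⟨ *-identityʳ b ⟩
      b                             ∎
    root : g * a + h * a′ ≡ f
    root = begin
      g * a + h * a′                ≡⟨ cong₂ _+_ ga≡r ha′≡r′ ⟩
      r + r′                        ≡⟨ solve 5 (λ b f g h m → (b :+ f :* h) :* m :+ (b :+ f :* g) :* m := f :* ((g :+ h) :* m)) refl b f g h m ⟩
      f * ((g + h) * m)             ≡⟨ cong (f *_) [g+h]m≡1 ⟩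
      f * 1#                        ≡⟨ *-identityʳ f ⟩
      f                             ∎
    square : g * g * (a * a) + h * h * (a′ * a′) ≡ f * f
    square = begin
      g * g * (a * a) + h * h * (a′ * a′)    ≡⟨ solve 4 (λ g h a a′ → g :* g :* (a :* a) :+ h :* h :* (a′ :* a′) := (g :* a :+ h :* a′) :* (g :* a :+ h :* a′)) refl g h a a′ ⟩
      (g * a + h * a′) * (g * a + h * a′)    ≡⟨ cong (λ t → t * t) root ⟩
      f * f                                  ∎

  𝒫-Comb : ∀ {α β} → α ≢ 0# → β ≢ 0# → α ≢ β → ∀ n (w : Vec Carrier (n ℕ.* 2)) →
    ∃₂ λ u v → 𝒫 n u × 𝒫 n v × Comb α β w u v
  𝒫-Comb α≢0 β≢0 α≢β zero    []          = [] , [] , tt , tt , tt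
  𝒫-Comb α≢0 β≢0 α≢β (suc n) (b ∷ c ∷ w) =
    let a , a′ , eq , eq′ = parabola-solve α≢0 β≢0 α≢β b c
        u , v , pu , pv , comb = 𝒫-Comb α≢0 β≢0 α≢β n w
    in a ∷ a * a ∷ u , a′ ∷ a′ * a′ ∷ v , (refl , pu) , (refl , pv) , eq , eq′ , comb

  -- This is the arc property of the conic of points (1, x, x²), with a + b + c = 0 as the relation
  -- between the first coordinates.
  parabola-cap : ∀ {a b c x y z} → a ≢ 0# → b ≢ 0# → c ≢ 0# → a + b + c ≡ 0# →
    a * x + b * y + c * z ≡ 0# → a * (x * x) + b * (y * y) + c * (z * z) ≡ 0# → x ≡ y × y ≡ z
  parabola-cap {a} {b} {c} {x} {y} {z} a≢0 b≢0 c≢0 a+b+c≡0 eq₁ eq₂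
    with refl ← +≡0⇒≡ a+b+c≡0 | (y + z) ≟ 0#
  ... | yes y+z≡0 with refl ← +≡0⇒≡ y+z≡0 = +≡0⇒≡ (*-cancelˡ-0 a≢0
          (trans (solve 4 (λ a b x y → a :* (x :+ y) := a :* x :+ b :* y :+ (a :+ b) :* y) refl a b x y) eq₁)) , refl
  -- Adding (x + z) times the linear relation to the quadratic one eliminates a and leaves b (y + z)
  -- (x + y) = 0.
  ... | no y+z≢0 with refl ← +≡0⇒≡ {x} {y} (*-cancelˡ-0 y+z≢0 (*-cancelˡ-0 b≢0
          (trans (solve 5 (λ a b x y z → b :* ((y :+ z) :* (x :+ y)) :=
                    (x :+ z) :* (a :* x :+ b :* y :+ (a :+ b) :* z) :+ (a :* (x :* x) :+ b :* (y :* y) :+ (a :+ b) :* (z :* z))) refl a b x y z)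
            (trans (cong₂ (λ s t → (x + z) * s + t) eq₁ eq₂) (trans (cong (_+ 0#) (zeroʳ (x + z))) (+-identityʳ 0#))))))
          = refl , +≡0⇒≡ (*-cancelˡ-0 c≢0
          (trans (solve 4 (λ a b y z → (a :+ b) :* (y :+ z) := a :* y :+ b :* y :+ (a :+ b) :* z) refl a b y z) eq₁))

  𝒫-cap : ∀ {a b c} → a ≢ 0# → b ≢ 0# → c ≢ 0# → a + b + c ≡ 0# →
    ∀ n u v w → 𝒫 n u → 𝒫 n v → 𝒫 n w → Dep₃ a b c u v w → u ≡ v × v ≡ w
  𝒫-cap _ _ _ _ zero [] [] [] _ _ _ _ = refl , refl
  𝒫-cap a≢0 b≢0 c≢0 eq (suc n) (x ∷ _ ∷ u) (y ∷ _ ∷ v) (z ∷ _ ∷ w) (refl , pu) (refl , pv) (refl , pw) (eq₁ , eq₂ , dep)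
    with refl , refl ← parabola-cap {x = x} {y} {z} a≢0 b≢0 c≢0 eq eq₁ eq₂
       | refl , refl ← 𝒫-cap a≢0 b≢0 c≢0 eq n u v w pu pv pw dep
    = refl , refl

  𝒫-⊕ : ∀ n u v → 𝒫 n u → 𝒫 n v → 𝒫 n (u ⊕ v)
  𝒫-⊕ zero    []          []          _           _           = tt
  𝒫-⊕ (suc n) (x ∷ _ ∷ u) (y ∷ _ ∷ v) (refl , pu) (refl , pv) =
    solve 2 (λ x y → x :* x :+ y :* y := (x :+ y) :* (x :+ y)) refl x y , 𝒫-⊕ n u v pu pv

  -- In characteristic 2 the relation says c w = a (u + v), and μ is a / c. With u and v on the
  -- parabolas, w becomes μ times a point of the parabolas.
  Dep₃⇒•⊕ : ∀ {n a c μ} → c ≢ 0# → c * μ ≡ a → (u v w : Vec Carrier n) → Dep₃ a a c u v w → w ≡ μ • (u ⊕ v)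
  Dep₃⇒•⊕ _ _ [] [] [] _ = refl
  Dep₃⇒•⊕ {c = c} {μ} c≢0 refl (x ∷ u) (y ∷ v) (z ∷ w) (eq , dep) = cong₂ _∷_
    (sym (+≡0⇒≡ (*-cancelˡ-0 c≢0
      (trans (solve 5 (λ c μ x y z → c :* (μ :* (x :+ y) :+ z) := c :* μ :* x :+ c :* μ :* y :+ c :* z) refl c μ x y z) eq))))
    (Dep₃⇒•⊕ c≢0 refl u v w dep)

  𝒫-zeros : ∀ n → 𝒫 n zeros
  𝒫-zeros zero    = tt
  𝒫-zeros (suc n) = sym (zeroˡ 0#) , 𝒫-zeros n

-- The set 𝒳 as a recursive tower of levels.

Normalized-++ : (𝔽 : FiniteField) → let open Geometry 𝔽 in
  ∀ {m n} (x : Vec Carrier m) {y : Vec Carrier n} → Normalized x → Normalized (x ++ y)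
Normalized-++ 𝔽 (a ∷ x) (inj₁ (a≡0 , nx)) = inj₁ (a≡0 , Normalized-++ 𝔽 x nx)
Normalized-++ 𝔽 (a ∷ x) (inj₂ a≡1)        = inj₂ a≡1

module Tower (𝔽 : FiniteField) (K : Geometry.PointSet 𝔽 2) where
  open Geometry 𝔽

  AvoidsParabolas : Set
  AvoidsParabolas = ∀ A a → S₁ K A → ¬ K (1# ∷ a ∷ A * (a * a) ∷ [])

  NoDiagonalPointAtInfinity : Set
  NoDiagonalPointAtInfinity = ∀ {y z} → K (0# ∷ y ∷ z ∷ []) → y ≢ z

  -- 𝒱 n is 𝒳 K n: a point of K^(j) with j < n arises from a point of 𝒱 (n - 1) by doubling
  -- the first coordinate and prefixing a zero.
  mutual
    𝒱 : (n : ℕ) → PointSet (2 ℕ.+ n ℕ.* 2)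
    𝒱 n (x ∷ y ∷ z ∷ v) = (K (x ∷ y ∷ z ∷ []) × 𝒫 n v) ⊎ Lifted n x y z v

    Lifted : (n : ℕ) → Carrier → Carrier → Carrier → Vec Carrier (n ℕ.* 2) → Set
    Lifted zero    x y z v = ⊥
    Lifted (suc n) x y z v = x ≡ 0# × y ≡ z × 𝒱 n (z ∷ v)

  -- The set of the theorem, split by the first coordinate into the points over `K₀` and the copy of
  -- `𝒱 n` at infinity.
  𝒯 : (n : ℕ) → PointSet (3 ℕ.+ n ℕ.* 2)
  𝒯 n (x ∷ e ∷ w) = (x ≡ 1# × (e ≡ 1# ⊎ e ≡ 0#) × 𝒫 (suc n) w) ⊎ (x ≡ 0# × 𝒱 n (e ∷ w))

  -- Embeds one level in the next. `Φ j t` is its (t + 1)-fold iterate, because on a vector that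
  -- starts with 0 it amounts to prefixing two zeros.
  lift : ∀ {n} → Vec Carrier (suc n) → Vec Carrier (3 ℕ.+ n)
  lift (x ∷ v) = 0# ∷ x ∷ x ∷ v

  lift-injective : ∀ {n} {v w : Vec Carrier (suc n)} → lift v ≡ lift w → v ≡ w
  lift-injective {v = _ ∷ _} {_ ∷ _} = Vec.∷-injectiveʳ ∘ Vec.∷-injectiveʳ

  𝒱-lift : ∀ n v → 𝒱 n v → 𝒱 (suc n) (lift v)
  𝒱-lift n (x ∷ v) v∈ = inj₂ (refl , refl , v∈)

  𝒱-++ : ∀ n x {v} → K x → 𝒫 n v → 𝒱 n (x ++ v)
  𝒱-++ n (_ ∷ _ ∷ _ ∷ []) kx pv = inj₁ (kx , pv)

  ∶⇒𝒱 : ∀ n v → (K ∶ 𝒫 n) v → 𝒱 n v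
  ∶⇒𝒱 n _ (x , y , _ , kx , py , refl) = 𝒱-++ n x kx py

  Φ⇒𝒱 : ∀ j t s (e : j ℕ.+ suc t ≡ s) y → (K ∶ 𝒫 j) y → 𝒱 s (Φ j t s e y)
  Φ⇒𝒱 j t zero e y _ = ⊥-elim (ℕ.1+n≢0 (trans (sym (ℕ.+-suc j t)) e))
  -- With a single leading zero the length equation forces j to be the level directly below, and the
  -- cast is then the identity.
  Φ⇒𝒱 j zero (suc s) e (y₀ ∷ y₁ ∷ y₂ ∷ y) y∈
    with refl ← trans (sym (ℕ.+-identityʳ j)) (ℕ.suc-injective (trans (sym (ℕ.+-suc j 0)) e)) =
    subst (λ v → 𝒱 (suc j) (0# ∷ y₀ ∷ y₀ ∷ y₁ ∷ y₂ ∷ v)) (sym (Vec.cast-is-id refl y))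
      (inj₂ (refl , refl , ∶⇒𝒱 j _ y∈))
  Φ⇒𝒱 j (suc t) (suc s) e (y₀ ∷ y) y∈ =
    inj₂ (refl , refl , Φ⇒𝒱 j t s (ℕ.suc-injective (trans (sym (ℕ.+-suc j (suc t))) e)) (y₀ ∷ y) y∈)

  𝒳⇒𝒱 : ∀ s v → 𝒳 K s v → 𝒱 s v
  𝒳⇒𝒱 s v (inj₁ v∈)                                 = ∶⇒𝒱 s v v∈
  𝒳⇒𝒱 s _ (inj₂ (j , _ , t , e , y , y∈ , refl)) = Φ⇒𝒱 j t s e y y∈

  module _ (K⇒Normalized : ∀ v → K v → Normalized v) where

    𝒱⇒Normalized : ∀ n v → 𝒱 n v → Normalized v
    𝒱⇒Normalized n (x ∷ y ∷ z ∷ v) (inj₁ (kx , _)) = Normalized-++ 𝔽 (x ∷ y ∷ z ∷ []) (K⇒Normalized _ kx)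
    𝒱⇒Normalized (suc n) (x ∷ y ∷ z ∷ v) (inj₂ (x≡0 , refl , zv∈)) with 𝒱⇒Normalized n (z ∷ v) zv∈
    ... | inj₁ (z≡0 , nv) = inj₁ (x≡0 , inj₁ (z≡0 , inj₁ (z≡0 , nv)))
    ... | inj₂ z≡1        = inj₁ (x≡0 , inj₂ z≡1)

    𝒯⇒Normalized : ∀ n v → 𝒯 n v → Normalized v
    𝒯⇒Normalized n (x ∷ e ∷ w) (inj₁ (x≡1 , _)) = inj₂ x≡1
    𝒯⇒Normalized n (x ∷ e ∷ w) (inj₂ (x≡0 , v∈)) = inj₁ (x≡0 , 𝒱⇒Normalized n _ v∈)

    𝒱⇒𝒳 : ∀ s v → 𝒱 s v → 𝒳 K s v
    𝒱⇒𝒳 s (x ∷ y ∷ z ∷ v) (inj₁ (kx , pv)) = inj₁ (x ∷ y ∷ z ∷ [] , v , K⇒Normalized _ kx , kx , pv , refl)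
    𝒱⇒𝒳 (suc s) (x ∷ y ∷ z ∷ v) (inj₂ (refl , refl , zv∈)) with 𝒱⇒𝒳 s (z ∷ v) zv∈
    -- Lifting keeps the index j and adds two zeros, so t grows by 1. A top point of level s starts
    -- as a member of K^(s) with t = 0.
    ... | inj₁ zv∈∶ = inj₂ (s , ℕ.≤-refl , 0 , ℕ.+-comm s 1 , z ∷ v , zv∈∶ ,
            cong (λ v → 0# ∷ z ∷ z ∷ v) (sym (Vec.cast-is-id _ v)))
    ... | inj₂ (j , j<s , t , e , y₀ ∷ y , y∈ , refl) =
            inj₂ (j , ℕ.m<n⇒m<1+n j<s , suc t , trans (ℕ.+-suc j (suc t)) (cong suc e) , y₀ ∷ y , y∈ , refl)

    𝒯⇒∪ : ∀ s v → 𝒯 s v → ((K₀ ∶ 𝒫 (suc s)) ∪ 𝒳̄′ K s) v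
    𝒯⇒∪ s (x ∷ e ∷ w) (inj₁ (refl , inj₁ refl , pw)) = inj₁ (1# ∷ 1# ∷ [] , w , inj₂ refl , inj₁ refl , pw , refl)
    𝒯⇒∪ s (x ∷ e ∷ w) (inj₁ (refl , inj₂ refl , pw)) = inj₁ (1# ∷ 0# ∷ [] , w , inj₂ refl , inj₂ refl , pw , refl)
    𝒯⇒∪ s (x ∷ e ∷ w) (inj₂ (refl , v∈)) = inj₂ (e ∷ w , 𝒱⇒𝒳 s _ v∈ , refl)

  ∪⇒𝒯 : ∀ s v → ((K₀ ∶ 𝒫 (suc s)) ∪ 𝒳̄′ K s) v → 𝒯 s v
  ∪⇒𝒯 s _ (inj₁ (_ , w , _ , inj₁ refl , pw , refl)) = inj₁ (refl , inj₁ refl , pw)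
  ∪⇒𝒯 s _ (inj₁ (_ , w , _ , inj₂ refl , pw , refl)) = inj₁ (refl , inj₂ refl , pw)
  ∪⇒𝒯 s _ (inj₂ (e ∷ w , v∈ , refl)) = inj₂ (refl , 𝒳⇒𝒱 s _ v∈)

-- The cap property.

module CapProof (𝔽 : FiniteField) (1+1≡0 : HasCharacteristic2 𝔽)
  (K : Geometry.PointSet 𝔽 2)
  (K⇒Normalized : ∀ v → K v → Geometry.Normalized 𝔽 v)
  (arc : Geometry.Cap 𝔽 K)
  (K∩l∞ : Geometry.MeetsLineAtInfinityIn₂ 𝔽 K)
  (K∩parabolas : Tower.AvoidsParabolas 𝔽 K)
  where
  open Geometry 𝔽
  open LinearDependence 𝔽 1+1≡0
  open Tower 𝔽 K

  [001]∈K : K (0# ∷ 0# ∷ 1# ∷ [])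
  [001]∈K = proj₁ (Equivalence.from (K∩l∞ _ (inj₁ (refl , inj₁ (refl , inj₂ refl)))) (inj₁ refl))

  [010]∈K : K (0# ∷ 1# ∷ 0# ∷ [])
  [010]∈K = proj₁ (Equivalence.from (K∩l∞ _ (inj₁ (refl , inj₂ refl))) (inj₂ refl))

  K-infinite : ∀ {y z} → K (0# ∷ y ∷ z ∷ []) → (y ≡ 0# × z ≡ 1#) ⊎ (y ≡ 1# × z ≡ 0#)
  K-infinite k with Equivalence.to (K∩l∞ _ (K⇒Normalized _ k)) (k , refl)
  ... | inj₁ refl = inj₁ (refl , refl)
  ... | inj₂ refl = inj₂ (refl , refl)

  -- The two points of K at infinity provide the sum 1, so the parabola with A = 1 is among the
  -- excluded ones.
  1∈S₁ : S₁ K 1#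
  1∈S₁ = 0# , 0# , 1# , 0# , 1# , 0# , K⇒Normalized _ [001]∈K , K⇒Normalized _ [010]∈K ,
    [001]∈K , [010]∈K , refl , 0≢1 , +-comm 1# 0# , sym (+-identityˡ 1#)

  head≡0∨1 : ∀ {n x} {v : Vec Carrier n} → Normalized (x ∷ v) → x ≡ 0# ⊎ x ≡ 1#
  head≡0∨1 (inj₁ (x≡0 , _)) = inj₁ x≡0
  head≡0∨1 (inj₂ x≡1)       = inj₂ x≡1

  -- With a = μ t and A = 1 / μ, the coordinates μ t and μ t² are a and A a². A top point would thus
  -- begin with a point of K on an excluded parabola, and lifted points begin with 0.
  1∷•𝒫∉𝒱 : ∀ {A μ} → S₁ K A → A * μ ≡ 1# → ∀ n w → 𝒫 (suc n) w → ¬ 𝒱 n (1# ∷ (μ • w))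
  1∷•𝒫∉𝒱 {A} {μ} A∈S₁ Aμ≡1 n (t ∷ _ ∷ w) (refl , _) (inj₁ (k , _)) =
    K∩parabolas A (μ * t) A∈S₁ (subst (λ z → K (1# ∷ μ * t ∷ z ∷ [])) (begin
      μ * (t * t)                  ≡⟨ *-identityˡ _ ⟨
      1# * (μ * (t * t))           ≡⟨ cong (_* (μ * (t * t))) Aμ≡1 ⟨
      A * μ * (μ * (t * t))        ≡⟨ solve 3 (λ A μ t → A :* μ :* (μ :* (t :* t)) := A :* (μ :* t :* (μ :* t))) refl A μ t ⟩
      A * (μ * t * (μ * t))        ∎) k)
    where open ≡-Reasoning
  1∷•𝒫∉𝒱 _ _ (suc n) (t ∷ _ ∷ w) _ (inj₂ (1≡0 , _)) = 0≢1 (sym 1≡0)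

  -- At the top, μ t and μ t² vanish together, whereas a point of K at infinity has exactly one zero
  -- among these coordinates. In a lifted point both equal the next leading coordinate: the value 0
  -- leads one level down, and the value 1 gives t = μ = 1 and the excluded case A = 1.
  0∷•𝒫∉𝒱 : ∀ {μ} n w → 𝒫 (suc n) w → ¬ 𝒱 n (0# ∷ (μ • w))
  0∷•𝒫∉𝒱 {μ} n (t ∷ _ ∷ w) (refl , _) (inj₁ (k , _)) with K-infinite k
  ... | inj₁ (μt≡0 , μtt≡1) = 0≢1 (begin
          0#             ≡⟨ zeroˡ t ⟨
          0# * t         ≡⟨ cong (_* t) μt≡0 ⟨
          μ * t * t      ≡⟨ *-assoc μ t t ⟩
          μ * (t * t)    ≡⟨ μtt≡1 ⟩
          1#             ∎)
    where open ≡-Reasoning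
  ... | inj₂ (μt≡1 , μtt≡0) = 0≢1 (begin
          0#             ≡⟨ zeroʳ μ ⟨
          μ * 0#         ≡⟨ cong (μ *_) μtt≡0 ⟨
          μ * (μ * (t * t))      ≡⟨ solve 2 (λ μ t → μ :* (μ :* (t :* t)) := μ :* t :* (μ :* t)) refl μ t ⟩
          μ * t * (μ * t)    ≡⟨ cong₂ _*_ μt≡1 μt≡1 ⟩
          1# * 1#        ≡⟨ *-identityˡ 1# ⟩
          1#             ∎)
    where open ≡-Reasoning
  0∷•𝒫∉𝒱 {μ} (suc n) (t ∷ _ ∷ w) (refl , pw) (inj₂ (_ , μt≡μtt , v∈))
    with head≡0∨1 (𝒱⇒Normalized K⇒Normalized n _ v∈)
  ... | inj₁ eq = 0∷•𝒫∉𝒱 n w pw (subst (λ d → 𝒱 n (d ∷ (μ • w))) eq v∈)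
  ... | inj₂ eq = 1∷•𝒫∉𝒱 1∈S₁ 1μ≡1 n w pw (subst (λ d → 𝒱 n (d ∷ (μ • w))) eq v∈)
    where
    open ≡-Reasoning
    t≡1 : t ≡ 1#
    t≡1 = begin
      t              ≡⟨ *-identityˡ t ⟨
      1# * t         ≡⟨ cong (_* t) (trans μt≡μtt eq) ⟨
      μ * t * t      ≡⟨ *-assoc μ t t ⟩
      μ * (t * t)    ≡⟨ eq ⟩
      1#             ∎
    1μ≡1 : 1# * μ ≡ 1#
    1μ≡1 = trans (*-comm 1# μ) (trans (cong (μ *_) (sym t≡1)) (trans μt≡μtt eq))

  -- Distinct points of `𝒱 n` may share their beginnings, so coincidences are allowed here. If two
  -- of the points agree, their terms merge and the third agrees too; three distinct points
  -- contradict the arc property.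
  arc-Dep₃ : ∀ {a b c} P Q R → a ≢ 0# → b ≢ 0# → c ≢ 0# → K P → K Q → K R → Dep₃ a b c P Q R → P ≡ Q × Q ≡ R
  arc-Dep₃ {a} {b} {c} P Q R a≢0 b≢0 c≢0 kP kQ kR dep
    with Vec.≡-dec _≟_ P Q | Vec.≡-dec _≟_ Q R | Vec.≡-dec _≟_ P R
  ... | yes refl | _ | _ = refl , sym (Dep₂⇒≡ R P c≢0 (K⇒Normalized R kR) (K⇒Normalized P kP) (Dep₃-merge P R dep))
  ... | no _ | yes refl | _ =
    Dep₂⇒≡ P Q a≢0 (K⇒Normalized P kP) (K⇒Normalized Q kQ) (Dep₃-merge Q P (Dep₃-rotate P Q Q dep)) , refl
  ... | no _ | no _ | yes refl =
    let Q≡P = Dep₂⇒≡ Q P b≢0 (K⇒Normalized Q kQ) (K⇒Normalized P kP)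
                (Dep₃-merge P Q (Dep₃-rotate Q P P (Dep₃-rotate P Q P dep)))
    in sym Q≡P , Q≡P
  ... | no P≢Q | no Q≢R | no P≢R = contradiction
    (a , b , c , (λ (a≡0 , _) → a≢0 a≡0) , Dep₃⇒≡zeros P Q R dep)
    (arc P Q R (K⇒Normalized P kP) (K⇒Normalized Q kQ) (K⇒Normalized R kR) kP kQ kR P≢Q Q≢R P≢R)

  -- The first coordinate gives a = b for two affine points and rules out one affine and one
  -- infinite point. Two infinite points must be (0,0,1) and (0,1,0), since a repeated one would
  -- give c = 0; adding the last two equations then gives a + b = 0.
  secant-through-[011] : ∀ {a b c x₀ x₁ x₂ y₀ y₁ y₂} → a ≢ 0# → b ≢ 0# → c ≢ 0# →
    K (x₀ ∷ x₁ ∷ x₂ ∷ []) → K (y₀ ∷ y₁ ∷ y₂ ∷ []) →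
    Dep₃ a b c (x₀ ∷ x₁ ∷ x₂ ∷ []) (y₀ ∷ y₁ ∷ y₂ ∷ []) (0# ∷ 1# ∷ 1# ∷ []) → a ≡ b × x₀ ≡ y₀
  secant-through-[011] {a} {b} {c} a≢0 b≢0 c≢0 kx ky (eq₀ , eq₁ , eq₂ , _)
    with head≡0∨1 (K⇒Normalized _ kx) | head≡0∨1 (K⇒Normalized _ ky)
  ... | inj₂ refl | inj₂ refl =
    +≡0⇒≡ (trans (solve 3 (λ a b c → a :+ b := a :* con true :+ b :* con true :+ c :* con false) refl a b c) eq₀) , refl
  ... | inj₂ refl | inj₁ refl = contradiction
    (trans (solve 3 (λ a b c → a := a :* con true :+ b :* con false :+ c :* con false) refl a b c) eq₀) a≢0
  ... | inj₁ refl | inj₂ refl = contradiction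
    (trans (solve 3 (λ a b c → b := a :* con false :+ b :* con true :+ c :* con false) refl a b c) eq₀) b≢0
  ... | inj₁ refl | inj₁ refl with K-infinite kx | K-infinite ky
  ... | inj₁ (refl , refl) | inj₁ (refl , refl) = contradiction
    (trans (solve 3 (λ a b c → c := a :* con false :+ b :* con false :+ c :* con true) refl a b c) eq₁) c≢0
  ... | inj₂ (refl , refl) | inj₂ (refl , refl) = contradiction
    (trans (solve 3 (λ a b c → c := a :* con false :+ b :* con false :+ c :* con true) refl a b c) eq₂) c≢0
  ... | inj₁ (refl , refl) | inj₂ (refl , refl) = +≡0⇒≡
    (trans (solve 3 (λ a b c → a :+ b := (a :* con false :+ b :* con true :+ c :* con true) :+ (a :* con true :+ b :* con false :+ c :* con true)) refl a b c)
      (trans (cong₂ _+_ eq₁ eq₂) (+-identityʳ 0#))) , refl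
  ... | inj₂ (refl , refl) | inj₁ (refl , refl) = +≡0⇒≡
    (trans (solve 3 (λ a b c → a :+ b := (a :* con false :+ b :* con true :+ c :* con true) :+ (a :* con true :+ b :* con false :+ c :* con true)) refl a b c)
      (trans (cong₂ _+_ eq₂ eq₁) (+-identityʳ 0#))) , refl

  quotient : ∀ {c} a → c ≢ 0# → ∃ λ μ → c * μ ≡ a
  quotient {c} a c≢0 with inverse c c≢0
  ... | c⁻¹ , cc⁻¹≡1 = c⁻¹ * a , trans (sym (*-assoc c c⁻¹ a)) (trans (cong (_* a) cc⁻¹≡1) (*-identityˡ a))

  -- Dividing the last two equations by a gives x₁ + y₁ = x₂ + y₂ = A, where A = c / a is nonzero,
  -- so that x₁ and y₁ differ.
  S₁-from-secant : ∀ {a c A x₀ x₁ x₂ y₁ y₂} → a ≢ 0# → c ≢ 0# → a * A ≡ c →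
    K (x₀ ∷ x₁ ∷ x₂ ∷ []) → K (x₀ ∷ y₁ ∷ y₂ ∷ []) →
    Dep₃ a a c (x₀ ∷ x₁ ∷ x₂ ∷ []) (x₀ ∷ y₁ ∷ y₂ ∷ []) (0# ∷ 1# ∷ 1# ∷ []) → S₁ K A
  S₁-from-secant {a} {c} {A} {x₀} {x₁} {x₂} {y₁} {y₂} a≢0 c≢0 refl kx ky (_ , eq₁ , eq₂ , _) =
    x₀ , x₁ , x₂ , x₀ , y₁ , y₂ , K⇒Normalized _ kx , K⇒Normalized _ ky , kx , ky , refl ,
    (λ { refl → c≢0 (trans (cong (a *_) (trans (sym (sum≡A eq₁)) (x+x≡0 x₁))) (zeroʳ a)) }) ,
    trans (sum≡A eq₂) (sym (sum≡A eq₁)) , sym (sum≡A eq₁)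
    where
    sum≡A : ∀ {x y} → a * x + a * y + a * A * 1# ≡ 0# → x + y ≡ A
    sum≡A {x} {y} eq = +≡0⇒≡ (*-cancelˡ-0 a≢0
      (trans (solve 4 (λ a A x y → a :* (x :+ y :+ A) := a :* x :+ a :* y :+ a :* A :* con true) refl a A x y) eq))

  drop-term : ∀ {x c} → x + c * 0# ≡ 0# → x ≡ 0#
  drop-term {x} {c} eq = trans (solve 2 (λ x c → x := x :+ c :* con false) refl x c) eq

  -- The lifted point begins with r (0,1,1). For r = 0 the other two beginnings coincide; for r = 1
  -- they span a secant through (0,1,1). Both cases give a = b, so w is μ (u + v) with μ = a / c,
  -- and for r = 1 the secant yields A = c / a, the inverse of μ.
  top-top-lifted : ∀ n {a b c x₀ x₁ x₂ y₀ y₁ y₂ r} (u v w : Vec Carrier (suc n ℕ.* 2)) → a ≢ 0# → b ≢ 0# → c ≢ 0# →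
    K (x₀ ∷ x₁ ∷ x₂ ∷ []) → K (y₀ ∷ y₁ ∷ y₂ ∷ []) → 𝒫 (suc n) u → 𝒫 (suc n) v → 𝒱 n (r ∷ w) →
    ¬ Dep₃ a b c (x₀ ∷ x₁ ∷ x₂ ∷ u) (y₀ ∷ y₁ ∷ y₂ ∷ v) (0# ∷ r ∷ r ∷ w)
  top-top-lifted n {a} {b} {c} {x₀} {x₁} {x₂} {y₀} {y₁} {y₂} u v w a≢0 b≢0 c≢0 kx ky pu pv r∈ (eq₀ , eq₁ , eq₂ , dep)
    with head≡0∨1 (𝒱⇒Normalized K⇒Normalized n _ r∈)
  ... | inj₁ refl
    with refl ← Dep₂⇒≡ {a = a} {b} (x₀ ∷ x₁ ∷ x₂ ∷ []) (y₀ ∷ y₁ ∷ y₂ ∷ []) a≢0 (K⇒Normalized _ kx) (K⇒Normalized _ ky)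
                  (drop-term eq₀ , drop-term eq₁ , drop-term eq₂ , tt)
    with refl ← +≡0⇒≡ (Dep₂-same {a = a} {b} (x₀ ∷ x₁ ∷ x₂ ∷ []) (K⇒Normalized _ kx)
                  (drop-term eq₀ , drop-term eq₁ , drop-term eq₂ , tt))
    with μ , cμ≡a ← quotient {c} a c≢0
    with refl ← Dep₃⇒•⊕ c≢0 cμ≡a u v w dep
    = 0∷•𝒫∉𝒱 n (u ⊕ v) (𝒫-⊕ (suc n) u v pu pv) r∈
  ... | inj₂ refl
    with refl , refl ← secant-through-[011] a≢0 b≢0 c≢0 kx ky (eq₀ , eq₁ , eq₂ , tt)
    with μ , cμ≡a ← quotient {c} a c≢0 | A , aA≡c ← quotient {a} c a≢0
    with refl ← Dep₃⇒•⊕ c≢0 cμ≡a u v w dep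
    = 1∷•𝒫∉𝒱 (S₁-from-secant a≢0 c≢0 aA≡c kx ky (eq₀ , eq₁ , eq₂ , tt))
        (*-cancelˡ a≢0 (trans (sym (*-assoc a A μ)) (trans (cong (_* μ) aA≡c) (trans cμ≡a (sym (*-identityʳ a))))))
        n (u ⊕ v) (𝒫-⊕ (suc n) u v pu pv) r∈

  -- Both lifted beginnings are multiples of (0,1,1), so the third would be one as well, but K has
  -- no such point.
  top-lifted-lifted : ∀ {n a b c x₀ x₁ x₂ r t} (u v w : Vec Carrier n) → a ≢ 0# → K (x₀ ∷ x₁ ∷ x₂ ∷ []) →
    ¬ Dep₃ a b c (x₀ ∷ x₁ ∷ x₂ ∷ u) (0# ∷ r ∷ r ∷ v) (0# ∷ t ∷ t ∷ w)
  top-lifted-lifted {a = a} {b} {c} {x₀} {x₁} {x₂} {r} {t} _ _ _ a≢0 kx (eq₀ , eq₁ , eq₂ , _)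
    with refl ← *-cancelˡ-0 a≢0 (drop-term (drop-term eq₀))
       | refl ← +≡0⇒≡ {x₁} {x₂} (*-cancelˡ-0 a≢0 (trans
           (solve 4 (λ a s x y → a :* (x :+ y) := (a :* x :+ s) :+ (a :* y :+ s)) refl a (b * r + c * t) x₁ x₂)
           (trans (cong₂ _+_ (trans (sym (+-assoc _ _ _)) eq₁) (trans (sym (+-assoc _ _ _)) eq₂)) (+-identityʳ 0#))))
    with K-infinite kx
  ... | inj₁ (refl , 0≡1) = 0≢1 0≡1
  ... | inj₂ (refl , 1≡0) = 0≢1 (sym 1≡0)

  -- The cases go by the number of lifted points. Rotation brings one or two of them into the
  -- positions treated above, and three of them descend to the level below by deleting the prefixed
  -- and doubled coordinates.
  𝒱-Dep₃ : ∀ n {a b c} P Q R → a ≢ 0# → b ≢ 0# → c ≢ 0# → 𝒱 n P → 𝒱 n Q → 𝒱 n R →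
    P ≢ Q → Q ≢ R → P ≢ R → ¬ Dep₃ a b c P Q R
  𝒱-Dep₃ n {a} {b} {c} (x₀ ∷ x₁ ∷ x₂ ∷ u) (y₀ ∷ y₁ ∷ y₂ ∷ v) (z₀ ∷ z₁ ∷ z₂ ∷ w) a≢0 b≢0 c≢0
    (inj₁ (kx , pu)) (inj₁ (ky , pv)) (inj₁ (kz , pw)) P≢Q _ _ (eq₀ , eq₁ , eq₂ , dep)
    with refl , refl ← arc-Dep₃ (x₀ ∷ x₁ ∷ x₂ ∷ []) (y₀ ∷ y₁ ∷ y₂ ∷ []) (z₀ ∷ z₁ ∷ z₂ ∷ [])
                         a≢0 b≢0 c≢0 kx ky kz (eq₀ , eq₁ , eq₂ , tt)
    with refl , refl ← 𝒫-cap a≢0 b≢0 c≢0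
           (trans (+-comm (a + b) c) (Dep₂-same (x₀ ∷ x₁ ∷ x₂ ∷ []) (K⇒Normalized _ kx)
             (Dep₃-merge (x₀ ∷ x₁ ∷ x₂ ∷ []) (x₀ ∷ x₁ ∷ x₂ ∷ []) (eq₀ , eq₁ , eq₂ , tt))))
           n u v w pu pv pw dep
    = P≢Q refl
  𝒱-Dep₃ (suc n) (_ ∷ _ ∷ _ ∷ u) (_ ∷ _ ∷ _ ∷ v) (_ ∷ _ ∷ _ ∷ w) a≢0 b≢0 c≢0
    (inj₁ (kx , pu)) (inj₁ (ky , pv)) (inj₂ (refl , refl , w∈)) _ _ _ dep =
    top-top-lifted n u v w a≢0 b≢0 c≢0 kx ky pu pv w∈ dep
  𝒱-Dep₃ (suc n) P@(_ ∷ _ ∷ _ ∷ u) Q@(_ ∷ _ ∷ _ ∷ v) R@(_ ∷ _ ∷ _ ∷ w) a≢0 b≢0 c≢0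
    (inj₁ (kx , pu)) (inj₂ (refl , refl , v∈)) (inj₁ (kz , pw)) _ _ _ dep =
    top-top-lifted n w u v c≢0 a≢0 b≢0 kz kx pw pu v∈ (Dep₃-rotate Q R P (Dep₃-rotate P Q R dep))
  𝒱-Dep₃ (suc n) P@(_ ∷ _ ∷ _ ∷ u) Q@(_ ∷ _ ∷ _ ∷ v) R@(_ ∷ _ ∷ _ ∷ w) a≢0 b≢0 c≢0
    (inj₂ (refl , refl , u∈)) (inj₁ (ky , pv)) (inj₁ (kz , pw)) _ _ _ dep =
    top-top-lifted n v w u b≢0 c≢0 a≢0 ky kz pv pw u∈ (Dep₃-rotate P Q R dep)
  𝒱-Dep₃ (suc n) (_ ∷ _ ∷ _ ∷ u) (_ ∷ _ ∷ _ ∷ v) (_ ∷ _ ∷ _ ∷ w) a≢0 b≢0 c≢0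
    (inj₁ (kx , _)) (inj₂ (refl , refl , _)) (inj₂ (refl , refl , _)) _ _ _ dep =
    top-lifted-lifted u v w a≢0 kx dep
  𝒱-Dep₃ (suc n) P@(_ ∷ _ ∷ _ ∷ u) Q@(_ ∷ _ ∷ _ ∷ v) R@(_ ∷ _ ∷ _ ∷ w) a≢0 b≢0 c≢0
    (inj₂ (refl , refl , _)) (inj₁ (ky , _)) (inj₂ (refl , refl , _)) _ _ _ dep =
    top-lifted-lifted v w u b≢0 ky (Dep₃-rotate P Q R dep)
  𝒱-Dep₃ (suc n) P@(_ ∷ _ ∷ _ ∷ u) Q@(_ ∷ _ ∷ _ ∷ v) R@(_ ∷ _ ∷ _ ∷ w) a≢0 b≢0 c≢0
    (inj₂ (refl , refl , _)) (inj₂ (refl , refl , _)) (inj₁ (kz , _)) _ _ _ dep =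
    top-lifted-lifted w u v c≢0 kz (Dep₃-rotate Q R P (Dep₃-rotate P Q R dep))
  𝒱-Dep₃ (suc n) (_ ∷ _ ∷ x ∷ u) (_ ∷ _ ∷ y ∷ v) (_ ∷ _ ∷ z ∷ w) a≢0 b≢0 c≢0
    (inj₂ (refl , refl , u∈)) (inj₂ (refl , refl , v∈)) (inj₂ (refl , refl , w∈)) P≢Q Q≢R P≢R (_ , _ , dep) =
    𝒱-Dep₃ n (x ∷ u) (y ∷ v) (z ∷ w) a≢0 b≢0 c≢0 u∈ v∈ w∈
      (P≢Q ∘ cong lift) (Q≢R ∘ cong lift) (P≢R ∘ cong lift) dep

  -- The first coordinate gives a = b, so w is μ (u + v) with μ = a / c. If r = 1, the second
  -- coordinate reads a (ε + ε′) = c; as c is nonzero, ε and ε′ differ, so a = c and μ = 1, which is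
  -- the excluded case A = 1.
  affine-affine-infinite : ∀ n {a b c ε ε′ r} (u v w : Vec Carrier (suc n ℕ.* 2)) → a ≢ 0# → c ≢ 0# →
    ε ≡ 1# ⊎ ε ≡ 0# → ε′ ≡ 1# ⊎ ε′ ≡ 0# → 𝒫 (suc n) u → 𝒫 (suc n) v → 𝒱 n (r ∷ w) →
    ¬ Dep₃ a b c (1# ∷ ε ∷ u) (1# ∷ ε′ ∷ v) (0# ∷ r ∷ w)
  affine-affine-infinite n {a} {b} {c} {ε} {ε′} u v w a≢0 c≢0 ε∈ ε′∈ pu pv r∈ (eq₀ , eq₁ , dep)
    with refl ← +≡0⇒≡ {a} {b} (trans (solve 2 (λ a b → a :+ b := a :* con true :+ b :* con true) refl a b) (drop-term eq₀))
    with μ , cμ≡a ← quotient {c} a c≢0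
    with refl ← Dep₃⇒•⊕ c≢0 cμ≡a u v w dep
    with head≡0∨1 (𝒱⇒Normalized K⇒Normalized n _ r∈)
  ... | inj₁ refl = 0∷•𝒫∉𝒱 n (u ⊕ v) (𝒫-⊕ (suc n) u v pu pv) r∈
  ... | inj₂ refl = 1∷•𝒫∉𝒱 1∈S₁ (trans (*-identityˡ μ) (*-cancelˡ c≢0 (trans cμ≡a (trans (a≡c ε∈ ε′∈) (sym (*-identityʳ c))))))
                      n (u ⊕ v) (𝒫-⊕ (suc n) u v pu pv) r∈
    where
    a≡c : ε ≡ 1# ⊎ ε ≡ 0# → ε′ ≡ 1# ⊎ ε′ ≡ 0# → a ≡ c
    a≡c (inj₁ refl) (inj₁ refl) = contradiction (trans (solve 2 (λ a c → c := a :* con true :+ a :* con true :+ c :* con true) refl a c) eq₁) c≢0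
    a≡c (inj₂ refl) (inj₂ refl) = contradiction (trans (solve 2 (λ a c → c := a :* con false :+ a :* con false :+ c :* con true) refl a c) eq₁) c≢0
    a≡c (inj₁ refl) (inj₂ refl) = +≡0⇒≡ (trans (solve 2 (λ a c → a :+ c := a :* con true :+ a :* con false :+ c :* con true) refl a c) eq₁)
    a≡c (inj₂ refl) (inj₁ refl) = +≡0⇒≡ (trans (solve 2 (λ a c → a :+ c := a :* con false :+ a :* con true :+ c :* con true) refl a c) eq₁)

  affine-infinite-infinite : ∀ {n a b c} (u v w : Vec Carrier n) → a ≢ 0# → ¬ Dep₃ a b c (1# ∷ u) (0# ∷ v) (0# ∷ w)
  affine-infinite-infinite {a = a} _ _ _ a≢0 (eq , _) = a≢0 (trans (sym (*-identityʳ a)) (drop-term (drop-term eq)))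

  𝒯-Dep₃ : ∀ n {a b c} P Q R → a ≢ 0# → b ≢ 0# → c ≢ 0# → 𝒯 n P → 𝒯 n Q → 𝒯 n R →
    P ≢ Q → Q ≢ R → P ≢ R → ¬ Dep₃ a b c P Q R
  𝒯-Dep₃ n {a} {b} {c} (_ ∷ ε ∷ u) (_ ∷ ε′ ∷ v) (_ ∷ ε″ ∷ w) a≢0 b≢0 c≢0
    (inj₁ (refl , ε∈ , pu)) (inj₁ (refl , ε′∈ , pv)) (inj₁ (refl , ε″∈ , pw)) P≢Q Q≢R P≢R (eq₀ , _ , dep)
    with refl , refl ← 𝒫-cap a≢0 b≢0 c≢0
           (trans (solve 3 (λ a b c → a :+ b :+ c := a :* con true :+ b :* con true :+ c :* con true) refl a b c) eq₀)
           (suc n) u v w pu pv pw dep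
    -- The parabola coordinates now agree, so the three points differ only in the second coordinate,
    -- which takes just two values.
    with ε∈ | ε′∈ | ε″∈
  ... | inj₁ refl | inj₁ refl | _         = P≢Q refl
  ... | inj₂ refl | inj₂ refl | _         = P≢Q refl
  ... | inj₁ refl | inj₂ refl | inj₁ refl = P≢R refl
  ... | inj₁ refl | inj₂ refl | inj₂ refl = Q≢R refl
  ... | inj₂ refl | inj₁ refl | inj₁ refl = Q≢R refl
  ... | inj₂ refl | inj₁ refl | inj₂ refl = P≢R refl
  𝒯-Dep₃ n (_ ∷ _ ∷ u) (_ ∷ _ ∷ v) (_ ∷ _ ∷ w) a≢0 b≢0 c≢0
    (inj₁ (refl , ε∈ , pu)) (inj₁ (refl , ε′∈ , pv)) (inj₂ (refl , w∈)) _ _ _ dep =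
    affine-affine-infinite n u v w a≢0 c≢0 ε∈ ε′∈ pu pv w∈ dep
  𝒯-Dep₃ n P@(_ ∷ _ ∷ u) Q@(_ ∷ _ ∷ v) R@(_ ∷ _ ∷ w) a≢0 b≢0 c≢0
    (inj₁ (refl , ε∈ , pu)) (inj₂ (refl , v∈)) (inj₁ (refl , ε″∈ , pw)) _ _ _ dep =
    affine-affine-infinite n w u v c≢0 b≢0 ε″∈ ε∈ pw pu v∈ (Dep₃-rotate Q R P (Dep₃-rotate P Q R dep))
  𝒯-Dep₃ n P@(_ ∷ _ ∷ u) Q@(_ ∷ _ ∷ v) R@(_ ∷ _ ∷ w) a≢0 b≢0 c≢0
    (inj₂ (refl , u∈)) (inj₁ (refl , ε′∈ , pv)) (inj₁ (refl , ε″∈ , pw)) _ _ _ dep =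
    affine-affine-infinite n v w u b≢0 a≢0 ε′∈ ε″∈ pv pw u∈ (Dep₃-rotate P Q R dep)
  𝒯-Dep₃ n (_ ∷ u@(_ ∷ _)) (_ ∷ v@(_ ∷ _)) (_ ∷ w@(_ ∷ _)) a≢0 b≢0 c≢0
    (inj₁ (refl , _)) (inj₂ (refl , _)) (inj₂ (refl , _)) _ _ _ dep = affine-infinite-infinite u v w a≢0 dep
  𝒯-Dep₃ n P@(_ ∷ u@(_ ∷ _)) Q@(_ ∷ v@(_ ∷ _)) R@(_ ∷ w@(_ ∷ _)) a≢0 b≢0 c≢0
    (inj₂ (refl , _)) (inj₁ (refl , _)) (inj₂ (refl , _)) _ _ _ dep =
    affine-infinite-infinite v w u b≢0 (Dep₃-rotate P Q R dep)
  𝒯-Dep₃ n P@(_ ∷ u@(_ ∷ _)) Q@(_ ∷ v@(_ ∷ _)) R@(_ ∷ w@(_ ∷ _)) a≢0 b≢0 c≢0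
    (inj₂ (refl , _)) (inj₂ (refl , _)) (inj₁ (refl , _)) _ _ _ dep =
    affine-infinite-infinite w u v c≢0 (Dep₃-rotate Q R P (Dep₃-rotate P Q R dep))
  𝒯-Dep₃ n (_ ∷ u@(_ ∷ _)) (_ ∷ v@(_ ∷ _)) (_ ∷ w@(_ ∷ _)) a≢0 b≢0 c≢0
    (inj₂ (refl , u∈)) (inj₂ (refl , v∈)) (inj₂ (refl , w∈)) P≢Q Q≢R P≢R (_ , dep) =
    𝒱-Dep₃ n u v w a≢0 b≢0 c≢0 u∈ v∈ w∈ (P≢Q ∘ cong (0# ∷_)) (Q≢R ∘ cong (0# ∷_)) (P≢R ∘ cong (0# ∷_)) dep

  𝒯-cap : ∀ n → Cap (𝒯 n)
  𝒯-cap n = cap-from-Dep₃ (𝒯 n) (𝒯-Dep₃ n)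

  -- The sum-point (0,1,1).

  Comb-coefficients-nonzero : ∀ {α β} Q P R → Normalized Q → ¬ K Q → K P → K R → Comb α β Q P R → α ≢ 0# × β ≢ 0#
  Comb-coefficients-nonzero Q P R nQ ¬kQ kP kR comb =
    (λ { refl → ¬kQ (multiple R kR (Comb-zeroˡ Q P R comb)) }) ,
    (λ { refl → ¬kQ (multiple P kP (Comb-zeroˡ Q R P (Comb-swap Q P R comb))) })
    where
    multiple : ∀ {α β} P → K P → Comb α β Q P P → K Q
    multiple P kP comb = subst K (sym (Dep₂⇒≡ Q P (0≢1 ∘ sym) nQ (K⇒Normalized P kP) (Comb-merge Q P comb))) kP

  [011] : Vec Carrier 3
  [011] = 0# ∷ 1# ∷ 1# ∷ []

  -- A combination equal to (0,1,1) is a relation with third coefficient 1, to which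
  -- `secant-through-[011]` applies. By uniqueness this identifies the sum-point of K.
  [011]-sumPoint : IsSumPoint K [011]
  [011]-sumPoint = n011 , ¬k011 , equal
    where
    n011 : Normalized [011]
    n011 = inj₁ (refl , inj₂ refl)
    ¬k011 : ¬ K [011]
    ¬k011 k with K-infinite k
    ... | inj₁ (1≡0 , _) = 0≢1 (sym 1≡0)
    ... | inj₂ (_ , 1≡0) = 0≢1 (sym 1≡0)
    equal : ∀ P₁ P₂ → Normalized P₁ → Normalized P₂ → K P₁ → K P₂ → P₁ ≢ P₂ →
      ∀ c₁ c₂ → [011] ≡ (c₁ • P₁) ⊕ (c₂ • P₂) → c₁ ≡ c₂
    equal P₁@(_ ∷ _ ∷ _ ∷ []) P₂@(_ ∷ _ ∷ _ ∷ []) _ _ k₁ k₂ _ c₁ c₂ eq =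
      let comb = ≡⇒Comb [011] P₁ P₂ eq
          c₁≢0 , c₂≢0 = Comb-coefficients-nonzero [011] P₁ P₂ n011 ¬k011 k₁ k₂ comb
      in proj₁ (secant-through-[011] c₁≢0 c₂≢0 (0≢1 ∘ sym) k₁ k₂ (Comb⇒Dep₃ [011] P₁ P₂ comb))

  -- Completeness.

  module CompletenessProof
    (K? : ∀ v → Dec (K v))
    (sumPoint-unique : ∀ Q → IsSumPoint K Q → Q ≡ [011])
    (ω : Carrier) (ω≢0 : ω ≢ 0#) (ω≢1 : ω ≢ 1#) where

    1+x≢0 : ∀ {x} → x ≢ 1# → 1# + x ≢ 0#
    1+x≢0 x≢1 eq = x≢1 (sym (+≡0⇒≡ eq))

    x≢1+x : ∀ {x} → x ≢ 1# + x
    x≢1+x {x} eq = 0≢1 (trans (sym (x+x≡0 x)) (trans (cong (x +_) eq) (solve 1 (λ x → x :+ (con true :+ x) := con true) refl x)))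

    x+[1+x]≡1 : ∀ x → x + (1# + x) ≡ 1#
    x+[1+x]≡1 = solve 1 (λ x → x :+ (con true :+ x) := con true) refl

    -- If α ≢ β, the secant that covers the first three coordinates extends to all parabola
    -- coordinates; hence only the sum-point can be the beginning of an uncovered point.
    uncovered⇒[011] : ∀ n y v → Normalized y →
      (∀ {α β} P R → 𝒱 n P → 𝒱 n R → ¬ Comb α β (y ++ v) P R) → y ≡ [011]
    uncovered⇒[011] n y v ny uncovered with K? y
    ... | yes ky =
      let u , u′ , pu , pu′ , comb = 𝒫-Comb ω≢0 (1+x≢0 ω≢1) x≢1+x n v
      in ⊥-elim (uncovered (y ++ u) (y ++ u′) (𝒱-++ n y ky pu) (𝒱-++ n y ky pu′)
                  (Comb-++ y y y (Comb-same (x+[1+x]≡1 ω) y) comb))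
    ... | no ¬ky = sumPoint-unique y (ny , ¬ky , λ P₁ P₂ _ _ k₁ k₂ _ c₁ c₂ eq →
      let comb₁ = ≡⇒Comb y P₁ P₂ eq
          c₁≢0 , c₂≢0 = Comb-coefficients-nonzero y P₁ P₂ ny ¬ky k₁ k₂ comb₁
      in decidable-stable (c₁ ≟ c₂) λ c₁≢c₂ →
           let u , u′ , pu , pu′ , comb₂ = 𝒫-Comb c₁≢0 c₂≢0 c₁≢c₂ n v
           in uncovered (P₁ ++ u) (P₂ ++ u′) (𝒱-++ n P₁ k₁ pu) (𝒱-++ n P₂ k₂ pu′) (Comb-++ y P₁ P₂ comb₁ comb₂))

    0≡α0+β0 : ∀ α β → 0# ≡ α * 0# + β * 0#
    0≡α0+β0 = solve 2 (λ α β → con false := α :* con false :+ β :* con false) refl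

    Comb-lift : ∀ {n α β} (Q P R : Vec Carrier (suc n)) → Comb α β Q P R → Comb α β (lift Q) (lift P) (lift R)
    Comb-lift {α = α} {β} (_ ∷ _) (_ ∷ _) (_ ∷ _) (eq , comb) = 0≡α0+β0 α β , eq , eq , comb

    -- A zero beginning passes to (0, v) one level down. The beginning (0,1,1) passes to (1, v),
    -- which the induction excludes, as its first coordinate is not 0. So only (0,...,0,1,1) can
    -- remain uncovered, and 1 = 1² places its tail on the parabolas.
    uncovered⇒0∷𝒫 : ∀ n x → Normalized x → (∀ {α β} P R → 𝒱 n P → 𝒱 n R → ¬ Comb α β x P R) →
      ∃ λ w → 𝒫 (suc n) w × x ≡ 0# ∷ w
    uncovered⇒0∷𝒫 n (x ∷ y ∷ z ∷ v) nx uncovered = split n v nx uncovered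
      where
      start : ∀ n v → Normalized (x ∷ y ∷ z ∷ []) →
        (∀ {α β} P R → 𝒱 n P → 𝒱 n R → ¬ Comb α β (x ∷ y ∷ z ∷ v) P R) →
        ∃ λ w → 𝒫 (suc n) w × x ∷ y ∷ z ∷ v ≡ 0# ∷ w
      start n v ny uncovered with refl ← uncovered⇒[011] n (x ∷ y ∷ z ∷ []) v ny uncovered = finish n v uncovered
        where
        finish : ∀ n v → (∀ {α β} P R → 𝒱 n P → 𝒱 n R → ¬ Comb α β (0# ∷ 1# ∷ 1# ∷ v) P R) →
          ∃ λ w → 𝒫 (suc n) w × 0# ∷ 1# ∷ 1# ∷ v ≡ 0# ∷ w
        finish zero [] _ = 1# ∷ 1# ∷ [] , (sym (*-identityˡ 1#) , tt) , refl
        finish (suc n) v uncovered with uncovered⇒0∷𝒫 n (1# ∷ v) (inj₂ refl)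
          (λ P R P∈ R∈ comb → uncovered (lift P) (lift R) (𝒱-lift n P P∈) (𝒱-lift n R R∈) (Comb-lift (1# ∷ v) P R comb))
        ... | _ , _ , eq = contradiction (sym (Vec.∷-injectiveˡ eq)) 0≢1

      split : ∀ n v → Normalized (x ∷ y ∷ z ∷ v) →
        (∀ {α β} P R → 𝒱 n P → 𝒱 n R → ¬ Comb α β (x ∷ y ∷ z ∷ v) P R) →
        ∃ λ w → 𝒫 (suc n) w × x ∷ y ∷ z ∷ v ≡ 0# ∷ w
      split n v (inj₂ x≡1) uncovered = start n v (inj₂ x≡1) uncovered
      split n v (inj₁ (x≡0 , inj₂ y≡1)) uncovered = start n v (inj₁ (x≡0 , inj₂ y≡1)) uncovered
      split n v (inj₁ (x≡0 , inj₁ (y≡0 , inj₂ z≡1))) uncovered = start n v (inj₁ (x≡0 , inj₁ (y≡0 , inj₂ z≡1))) uncovered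
      split zero [] (inj₁ (_ , inj₁ (_ , inj₁ (_ , ())))) _
      split (suc n) v (inj₁ (refl , inj₁ (refl , inj₁ (refl , nv)))) uncovered
        with uncovered⇒0∷𝒫 n (0# ∷ v) (inj₁ (refl , nv))
          (λ P R P∈ R∈ comb → uncovered (lift P) (lift R) (𝒱-lift n P P∈) (𝒱-lift n R R∈) (Comb-lift (0# ∷ v) P R comb))
      ... | w , pw , refl = 0# ∷ 0# ∷ w , (sym (zeroˡ 0#) , pw) , refl

    Comb-zeros : ∀ {n} (w : Vec Carrier n) → Comb 1# 1# w zeros w
    Comb-zeros []      = tt
    Comb-zeros (x ∷ w) = solve 1 (λ x → x := con true :* con false :+ con true :* x) refl x , Comb-zeros w

    K₀∶-covers : ∀ n e w → e ≡ 1# ⊎ e ≡ 0# → ¬ (∀ {α β} P R → 𝒯 n P → 𝒯 n R → ¬ Comb α β (1# ∷ e ∷ w) P R)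
    K₀∶-covers n e w e∈ uncovered =
      let u , u′ , pu , pu′ , comb = 𝒫-Comb ω≢0 (1+x≢0 ω≢1) x≢1+x (suc n) w
      in uncovered (1# ∷ e ∷ u) (1# ∷ e ∷ u′) (inj₁ (refl , e∈ , pu)) (inj₁ (refl , e∈ , pu′))
           (Comb-++ (1# ∷ e ∷ []) (1# ∷ e ∷ []) (1# ∷ e ∷ []) (Comb-same (x+[1+x]≡1 ω) (1# ∷ e ∷ [])) comb)

    𝒯-covers : ∀ n Q → Normalized Q → ¬ (∀ {α β} P R → 𝒯 n P → 𝒯 n R → ¬ Comb α β Q P R)
    𝒯-covers n (_ ∷ e ∷ w) (inj₁ (refl , nQ)) uncovered
      with uncovered⇒0∷𝒫 n (e ∷ w) nQ (λ {α} {β} P R P∈ R∈ comb →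
             uncovered (0# ∷ P) (0# ∷ R) (infinite P P∈) (infinite R R∈) (0≡α0+β0 α β , comb))
      where
      infinite : ∀ P → 𝒱 n P → 𝒯 n (0# ∷ P)
      infinite (_ ∷ _) P∈ = inj₂ (refl , P∈)
    -- The remaining point (0, 0, w) is the sum of (1, 0, 0,...,0) and (1, 0, w), both of which lie
    -- over the point (1, 0) of `K₀`.
    ... | w , pw , refl = uncovered {1#} {1#} (1# ∷ 0# ∷ zeros) (1# ∷ 0# ∷ w)
      (inj₁ (refl , inj₂ refl , 𝒫-zeros (suc n))) (inj₁ (refl , inj₂ refl , pw))
      (solve 0 (con false := con true :* con true :+ con true :* con true) refl , 0≡α0+β0 1# 1# , Comb-zeros w)
    𝒯-covers n (_ ∷ e ∷ w) (inj₂ refl) uncovered with e ≟ 0# | e ≟ 1#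
    -- Here (1, e) = e (1, 1) + (1 + e) (1, 0), with distinct nonzero coefficients.
    ... | no e≢0 | no e≢1 =
      let u , u′ , pu , pu′ , comb = 𝒫-Comb e≢0 (1+x≢0 e≢1) x≢1+x (suc n) w
      in uncovered (1# ∷ 1# ∷ u) (1# ∷ 0# ∷ u′) (inj₁ (refl , inj₁ refl , pu)) (inj₁ (refl , inj₂ refl , pu′))
           ( solve 1 (λ e → con true := e :* con true :+ (con true :+ e) :* con true) refl e
           , solve 1 (λ e → e := e :* con true :+ (con true :+ e) :* con false) refl e
           , comb)
    ... | yes e≡0 | _       = K₀∶-covers n e w (inj₂ e≡0) uncovered
    ... | no _    | yes e≡1 = K₀∶-covers n e w (inj₁ e≡1) uncovered

    𝒯-complete : ∀ n Q → Normalized Q → ¬ 𝒯 n Q → ¬ Cap (insert Q (𝒯 n))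
    𝒯-complete n Q nQ ¬tQ cap = 𝒯-covers n Q nQ
      (cap-insert⇒¬Comb (𝒯⇒Normalized K⇒Normalized n) Q nQ ¬tQ cap)

  -- A field element other than 0 and 1.

  size≥3 : ∀ {k} → HasSize K k → (∀ Q → IsSumPoint K Q → Q ≡ [011]) → 3 ≤ k
  size≥3 (l , l! , ∈l⇔ , refl) sumPoint-unique with any? (λ P → ¬? (head P ≟ 0#)) l
  ... | yes p = let P , P∈l , P₀≢0 = find p in
    unique-⊆⇒length≤ {xs = P List.∷ (0# ∷ 0# ∷ 1# ∷ []) List.∷ (0# ∷ 1# ∷ 0# ∷ []) List.∷ List.[]}
      (((P₀≢0 ∘ cong head) All.∷ (P₀≢0 ∘ cong head) All.∷ All.[]) AllPairs.∷
       ((λ eq → 0≢1 (cong (λ { (_ ∷ y ∷ _) → y }) eq)) All.∷ All.[]) AllPairs.∷ All.[] AllPairs.∷ AllPairs.[])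
      λ { (here refl) → P∈l
        ; (there (here refl)) → Equivalence.from (∈l⇔ _) (K⇒Normalized _ [001]∈K , [001]∈K)
        ; (there (there (here refl))) → Equivalence.from (∈l⇔ _) (K⇒Normalized _ [010]∈K , [010]∈K) }
  -- Without affine points in K the point (1,0,0) would vacuously be a second sum-point.
  ... | no ¬p = contradiction (sym (Vec.∷-injectiveˡ (sumPoint-unique (1# ∷ 0# ∷ 0# ∷ []) (inj₂ refl , ¬affine (0≢1 ∘ sym) ,
      λ { P₁@(_ ∷ _ ∷ _ ∷ []) P₂@(_ ∷ _ ∷ _ ∷ []) _ _ k₁ k₂ _ c₁ c₂ eq → ⊥-elim (0≢1 (sym (trans (Vec.∷-injectiveˡ eq)
        (trans (cong₂ (λ x y → c₁ * x + c₂ * y) (infinite k₁) (infinite k₂))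
          (solve 2 (λ c₁ c₂ → c₁ :* con false :+ c₂ :* con false := con false) refl c₁ c₂))))) })))) 0≢1
    where
    ¬affine : ∀ {x y z} → x ≢ 0# → ¬ K (x ∷ y ∷ z ∷ [])
    ¬affine x≢0 k = ¬p (Any.map (λ { refl → x≢0 }) (Equivalence.from (∈l⇔ _) (K⇒Normalized _ k , k)))
    infinite : ∀ {x y z} → K (x ∷ y ∷ z ∷ []) → x ≡ 0#
    infinite {x} k = decidable-stable (x ≟ 0#) (λ x≢0 → ¬affine x≢0 k)

  -- The line at infinity is a secant through the sum-point: (0,0,1) + (0,1,0) = (0,1,1).
  secants-exist : ∀ {p} → SecantCount K [011] p → 1 ≤ p
  secants-exist {suc p} _ = s≤s z≤n
  secants-exist {zero} (List.[] , _ , ∈l⇔ , _) with Equivalence.from (∈l⇔ (0# ∷ 0# ∷ 1# ∷ []) (0# ∷ 1# ∷ 0# ∷ []))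
    ( K⇒Normalized _ [001]∈K , K⇒Normalized _ [010]∈K , [001]∈K , [010]∈K
    , (λ eq → 0≢1 (cong (λ { (_ ∷ y ∷ _) → y }) eq))
    , 1# , 1# , 1# , (λ (1≡0 , _) → 0≢1 (sym 1≡0))
    , Dep₃⇒≡zeros (0# ∷ 0# ∷ 1# ∷ []) (0# ∷ 1# ∷ 0# ∷ []) [011]
        ( solve 0 (con true :* con false :+ con true :* con false :+ con true :* con false := con false) refl
        , solve 0 (con true :* con false :+ con true :* con true :+ con true :* con true := con false) refl
        , solve 0 (con true :* con true :+ con true :* con false :+ con true :* con true := con false) refl , tt))
  ... | ()

  -- Both k - 2 and p are at least 1, so the bound gives 1 < q - 1, which fails in a field with only
  -- the elements 0 and 1.
  third-element : ∀ {k p} → HasSize K k → (∀ Q → IsSumPoint K Q → Q ≡ [011]) → SecantCount K [011] p →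
    (k ∸ 2) ℕ.* p < q ∸ 1 → ∃ λ ω → ω ≢ 0# × ω ≢ 1#
  third-element {k} {p} size sumPoint-unique secants bound
    with any? (λ x → ¬? (x ≟ 0#) ×-dec ¬? (x ≟ 1#)) elements
  ... | yes found = let ω , _ , ω≢0 , ω≢1 = find found in ω , ω≢0 , ω≢1
  ... | no ¬found = contradiction (begin-strict
      1                  ≤⟨ ℕ.*-mono-≤ (ℕ.∸-monoˡ-≤ 2 (size≥3 size sumPoint-unique)) (secants-exist secants) ⟩
      (k ∸ 2) ℕ.* p      <⟨ bound ⟩
      q ∸ 1              ≤⟨ ℕ.∸-monoˡ-≤ 1 (unique-⊆⇒length≤ unique 𝔽⊆01) ⟩
      1                  ∎) (ℕ.<-irrefl refl)
    where
    open ℕ.≤-Reasoning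
    𝔽⊆01 : elements ⊆ 0# List.∷ 1# List.∷ List.[]
    𝔽⊆01 {x} x∈ with x ≟ 0# | x ≟ 1#
    ... | yes refl | _        = here refl
    ... | no _     | yes refl = there (here refl)
    ... | no x≢0   | no x≢1   = contradiction (Any.map (λ { refl → x≢0 , x≢1 }) x∈) ¬found

-- The number of points.

module Size (𝔽 : FiniteField) (K : Geometry.PointSet 𝔽 2)
  (K⇒Normalized : ∀ v → K v → Geometry.Normalized 𝔽 v)
  (K-infinite-distinct : Tower.NoDiagonalPointAtInfinity 𝔽 K)
  {k : ℕ} (size : Geometry.HasSize 𝔽 K k) where
  open Geometry 𝔽
  open Tower 𝔽 K

  private
    points : List (Vec Carrier 3)
    points = proj₁ size

    points! : Unique points
    points! = proj₁ (proj₂ size)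

  𝒫-list : ∀ n → List (Vec Carrier (n ℕ.* 2))
  𝒫-list zero    = [] List.∷ List.[]
  𝒫-list (suc n) = cartesianProductWith (λ a v → a ∷ a * a ∷ v) elements (𝒫-list n)

  𝒫-list-unique : ∀ n → Unique (𝒫-list n)
  𝒫-list-unique zero    = All.[] AllPairs.∷ AllPairs.[]
  𝒫-list-unique (suc n) = Uniq.cartesianProductWith⁺ _
    (λ eq → Vec.∷-injectiveˡ eq , Vec.∷-injectiveʳ (Vec.∷-injectiveʳ eq)) unique (𝒫-list-unique n)

  ∈-𝒫-list⁺ : ∀ n v → 𝒫 n v → v ∈ 𝒫-list n
  ∈-𝒫-list⁺ zero    []          _           = here refl
  ∈-𝒫-list⁺ (suc n) (a ∷ _ ∷ v) (refl , pv) = ∈-cartesianProductWith⁺ _ (complete a) (∈-𝒫-list⁺ n v pv)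

  ∈-𝒫-list⁻ : ∀ n v → v ∈ 𝒫-list n → 𝒫 n v
  ∈-𝒫-list⁻ zero    []  _ = tt
  ∈-𝒫-list⁻ (suc n) v v∈ with ∈-cartesianProductWith⁻ _ elements (𝒫-list n) v∈
  ... | a , u , _ , u∈ , refl = refl , ∈-𝒫-list⁻ n u u∈

  length-𝒫-list : ∀ n → length (𝒫-list n) ≡ q ^ n
  length-𝒫-list zero    = refl
  length-𝒫-list (suc n) = trans (length-cartesianProductWith _ elements (𝒫-list n)) (cong (q ℕ.*_) (length-𝒫-list n))

  top-list : ∀ n → List (Vec Carrier (3 ℕ.+ n ℕ.* 2))
  top-list n = cartesianProductWith _++_ points (𝒫-list n)

  top-list-unique : ∀ n → Unique (top-list n)
  top-list-unique n = Uniq.cartesianProductWith⁺ _++_ (λ {w} {x} → Vec.++-injective w x) points! (𝒫-list-unique n)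

  ∈-top-list⁺ : ∀ n {x y z v} → K (x ∷ y ∷ z ∷ []) → 𝒫 n v → (x ∷ y ∷ z ∷ v) ∈ top-list n
  ∈-top-list⁺ n {v = v} kx pv = ∈-cartesianProductWith⁺ _++_
    (Equivalence.from (proj₁ (proj₂ (proj₂ size)) _) (K⇒Normalized _ kx , kx)) (∈-𝒫-list⁺ n v pv)

  ∈-top-list⁻ : ∀ n {x y z v} → (x ∷ y ∷ z ∷ v) ∈ top-list n → K (x ∷ y ∷ z ∷ []) × 𝒫 n v
  ∈-top-list⁻ n v∈ with ∈-cartesianProductWith⁻ _++_ points (𝒫-list n) v∈
  ... | (_ ∷ _ ∷ _ ∷ []) , u , x∈ , u∈ , refl =
    proj₂ (Equivalence.to (proj₁ (proj₂ (proj₂ size)) _) x∈) , ∈-𝒫-list⁻ n u u∈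

  length-top-list : ∀ n → length (top-list n) ≡ k ℕ.* q ^ n
  length-top-list n = trans (length-cartesianProductWith _++_ points (𝒫-list n))
    (cong₂ ℕ._*_ (proj₂ (proj₂ (proj₂ size))) (length-𝒫-list n))

  𝒱-list : ∀ n → List (Vec Carrier (3 ℕ.+ n ℕ.* 2))
  𝒱-list zero    = top-list zero
  𝒱-list (suc n) = top-list (suc n) List.++ List.map lift (𝒱-list n)

  𝒱-list-unique : ∀ n → Unique (𝒱-list n)
  𝒱-list-unique zero    = top-list-unique zero
  𝒱-list-unique (suc n) = Uniq.++⁺ (top-list-unique (suc n)) (Uniq.map⁺ lift-injective (𝒱-list-unique n)) disjoint
    where
    disjoint : Disjoint (top-list (suc n)) (List.map lift (𝒱-list n))
    disjoint (v∈top , v∈lift) with ∈-map⁻ lift v∈lift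
    -- A common member would give a point (0, z, z) of K.
    ... | _ ∷ _ , _ , refl = K-infinite-distinct (proj₁ (∈-top-list⁻ (suc n) v∈top)) refl

  ∈-𝒱-list⁺ : ∀ n v → 𝒱 n v → v ∈ 𝒱-list n
  ∈-𝒱-list⁺ zero    (_ ∷ _ ∷ _ ∷ v) (inj₁ (kx , pv)) = ∈-top-list⁺ zero kx pv
  ∈-𝒱-list⁺ (suc n) (_ ∷ _ ∷ _ ∷ v) (inj₁ (kx , pv)) = ∈-++⁺ˡ (∈-top-list⁺ (suc n) kx pv)
  ∈-𝒱-list⁺ (suc n) (_ ∷ _ ∷ z ∷ v) (inj₂ (refl , refl , zv∈)) =
    ∈-++⁺ʳ (top-list (suc n)) (∈-map⁺ lift (∈-𝒱-list⁺ n (z ∷ v) zv∈))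

  ∈-𝒱-list⁻ : ∀ n v → v ∈ 𝒱-list n → 𝒱 n v
  ∈-𝒱-list⁻ zero    (_ ∷ _ ∷ _ ∷ v) v∈ = inj₁ (∈-top-list⁻ zero v∈)
  ∈-𝒱-list⁻ (suc n) v@(_ ∷ _ ∷ _ ∷ _) v∈ with ∈-++⁻ (top-list (suc n)) v∈
  ... | inj₁ v∈top = inj₁ (∈-top-list⁻ (suc n) v∈top)
  ... | inj₂ v∈lift with ∈-map⁻ lift v∈lift
  ...   | u@(_ ∷ _) , u∈ , refl = 𝒱-lift n u (∈-𝒱-list⁻ n u u∈)

  length-𝒱-list : ∀ n → length (𝒱-list n) ≡ k ℕ.* geomSum q n
  length-𝒱-list zero    = length-top-list zero
  length-𝒱-list (suc n) = begin
    length (top-list (suc n) List.++ List.map lift (𝒱-list n))          ≡⟨ length-++ (top-list (suc n)) ⟩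
    length (top-list (suc n)) ℕ.+ length (List.map lift (𝒱-list n))     ≡⟨ cong₂ ℕ._+_ (length-top-list (suc n)) (trans (length-map lift (𝒱-list n)) (length-𝒱-list n)) ⟩
    k ℕ.* q ^ suc n ℕ.+ k ℕ.* geomSum q n                               ≡⟨ ℕ.*-distribˡ-+ k (q ^ suc n) (geomSum q n) ⟨
    k ℕ.* geomSum q (suc n)                                             ∎
    where open ≡-Reasoning

  K₀-list : List Carrier
  K₀-list = 1# List.∷ 0# List.∷ List.[]

  affine : ∀ {n} → Carrier → Vec Carrier n → Vec Carrier (2 ℕ.+ n)
  affine e w = 1# ∷ e ∷ w

  affine-list : ∀ n → List (Vec Carrier (4 ℕ.+ n ℕ.* 2))
  affine-list n = cartesianProductWith affine K₀-list (𝒫-list (suc n))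

  𝒯-list : ∀ n → List (Vec Carrier (4 ℕ.+ n ℕ.* 2))
  𝒯-list n = affine-list n List.++ List.map (0# ∷_) (𝒱-list n)

  𝒯-list-unique : ∀ n → Unique (𝒯-list n)
  𝒯-list-unique n = Uniq.++⁺
    (Uniq.cartesianProductWith⁺ affine (λ eq → Vec.∷-injectiveˡ (Vec.∷-injectiveʳ eq) , Vec.∷-injectiveʳ (Vec.∷-injectiveʳ eq))
      (((0≢1 ∘ sym) All.∷ All.[]) AllPairs.∷ All.[] AllPairs.∷ AllPairs.[]) (𝒫-list-unique (suc n)))
    (Uniq.map⁺ Vec.∷-injectiveʳ (𝒱-list-unique n)) disjoint
    where
    disjoint : Disjoint (affine-list n) (List.map (0# ∷_) (𝒱-list n))
    disjoint (v∈affine , v∈infinite)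
      with ∈-cartesianProductWith⁻ affine K₀-list (𝒫-list (suc n)) v∈affine | ∈-map⁻ (0# ∷_) v∈infinite
    ... | _ , _ , _ , _ , refl | _ , _ , eq = 0≢1 (sym (Vec.∷-injectiveˡ eq))

  ∈-𝒯-list⁺ : ∀ n v → 𝒯 n v → v ∈ 𝒯-list n
  ∈-𝒯-list⁺ n (_ ∷ e ∷ w) (inj₁ (refl , e∈ , pw)) =
    ∈-++⁺ˡ (∈-cartesianProductWith⁺ affine (∈K₀ e∈) (∈-𝒫-list⁺ (suc n) w pw))
    where
    ∈K₀ : ∀ {e} → e ≡ 1# ⊎ e ≡ 0# → e ∈ K₀-list
    ∈K₀ (inj₁ refl) = here refl
    ∈K₀ (inj₂ refl) = there (here refl)
  ∈-𝒯-list⁺ n (_ ∷ e ∷ w) (inj₂ (refl , v∈)) = ∈-++⁺ʳ (affine-list n) (∈-map⁺ (0# ∷_) (∈-𝒱-list⁺ n (e ∷ w) v∈))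

  ∈-𝒯-list⁻ : ∀ n v → v ∈ 𝒯-list n → 𝒯 n v
  ∈-𝒯-list⁻ n v v∈ with ∈-++⁻ (affine-list n) v∈
  ... | inj₂ v∈infinite with ∈-map⁻ (0# ∷_) v∈infinite
  ...   | u@(_ ∷ _) , u∈ , refl = inj₂ (refl , ∈-𝒱-list⁻ n u u∈)
  ∈-𝒯-list⁻ n v v∈ | inj₁ v∈affine with ∈-cartesianProductWith⁻ affine K₀-list (𝒫-list (suc n)) v∈affine
  ... | _ , w , here refl , w∈ , refl         = inj₁ (refl , inj₁ refl , ∈-𝒫-list⁻ (suc n) w w∈)
  ... | _ , w , there (here refl) , w∈ , refl = inj₁ (refl , inj₂ refl , ∈-𝒫-list⁻ (suc n) w w∈)

  length-𝒯-list : ∀ n → length (𝒯-list n) ≡ 2 ℕ.* q ^ suc n ℕ.+ k ℕ.* geomSum q n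
  length-𝒯-list n = trans (length-++ (affine-list n)) (cong₂ ℕ._+_
    (trans (length-cartesianProductWith affine K₀-list (𝒫-list (suc n))) (cong (2 ℕ.*_) (length-𝒫-list (suc n))))
    (trans (length-map (0# ∷_) (𝒱-list n)) (length-𝒱-list n)))

-- Transfer from the recursive description to the given union.

theorem4p6 : (𝔽 : FiniteField) → let open Geometry 𝔽 in
    (s : ℕ) → 1 ≤ s → IsPowerOf2 q →
    (K : PointSet 2) (k : ℕ) →
    (∀ v → K v → Normalized v) →
    HasSize K k → CompleteArc K →
    (∃ λ Q → IsSumPoint K Q × (∀ Q′ → IsSumPoint K Q′ → Q′ ≡ Q) ×
    ∃ λ p → SecantCount K Q p × (k ∸ 2) ℕ.* p < q ∸ 1) →
    MeetsLineAtInfinityIn₂ K →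
    (∀ A a → S₁ K A → ¬ K (1# ∷ a ∷ A * (a * a) ∷ [])) →
    CompleteCap ((K₀ ∶ 𝒫 (suc s)) ∪ 𝒳̄′ K s) ×
    HasSize ((K₀ ∶ 𝒫 (suc s)) ∪ 𝒳̄′ K s) (2 ℕ.* q ^ (suc s) ℕ.+ k ℕ.* geomSum q s)
theorem4p6 𝔽 s _ q≡2^m K k K⇒N size@(points , _ , ∈points⇔ , _) (arc , _) (Q , _ , Q-unique , p , secants , bound) K∩l∞ K∩parabolas =
  ((λ P Q R nP nQ nR sP sQ sR → 𝒯-cap s P Q R nP nQ nR (∪⇒𝒯 s P sP) (∪⇒𝒯 s Q sQ) (∪⇒𝒯 s R sR)) ,
   (λ Q nQ ¬sQ cap → 𝒯-complete s Q nQ (¬sQ ∘ 𝒯⇒∪ K⇒N s Q) (λ P₁ P₂ P₃ n₁ n₂ n₃ t₁ t₂ t₃ →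
     cap P₁ P₂ P₃ n₁ n₂ n₃ (insert⁺ t₁) (insert⁺ t₂) (insert⁺ t₃)))) ,
  𝒯-list s , 𝒯-list-unique s ,
  (λ v → mk⇔ (λ v∈ → let tv = ∈-𝒯-list⁻ s v v∈ in 𝒯⇒Normalized K⇒N s v tv , 𝒯⇒∪ K⇒N s v tv)
             (λ (_ , sv) → ∈-𝒯-list⁺ s v (∪⇒𝒯 s v sv))) ,
  length-𝒯-list s
  where
  open Geometry 𝔽
  1+1≡0 = FieldProperties.characteristic-2 𝔽 q≡2^m
  open Tower 𝔽 K
  open CapProof 𝔽 1+1≡0 K K⇒N arc K∩l∞ K∩parabolas

  -- The given sum-point is (0,1,1), so the given secant count is a count of secants through
  -- (0,1,1).
  Q≡[011] : Q ≡ [011]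
  Q≡[011] = sym (Q-unique [011] [011]-sumPoint)

  sumPoint-unique : ∀ Q′ → IsSumPoint K Q′ → Q′ ≡ [011]
  sumPoint-unique Q′ sum = trans (Q-unique Q′ sum) Q≡[011]

  ω∃ : ∃ λ ω → ω ≢ 0# × ω ≢ 1#
  ω∃ = third-element size sumPoint-unique (subst (λ Q → SecantCount K Q p) Q≡[011] secants) bound

  -- `K` is an arbitrary predicate; the list of its points decides membership.
  K? : ∀ v → Dec (K v)
  K? v = map′ (proj₂ ∘ Equivalence.to (∈points⇔ v)) (λ kv → Equivalence.from (∈points⇔ v) (K⇒N v kv , kv))
    (any? (Vec.≡-dec _≟_ v) points)

  open CompletenessProof K? sumPoint-unique (proj₁ ω∃) (proj₁ (proj₂ ω∃)) (proj₂ (proj₂ ω∃))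

  K-infinite-distinct : NoDiagonalPointAtInfinity
  K-infinite-distinct k refl with K-infinite k
  ... | inj₁ (refl , 0≡1) = 0≢1 0≡1
  ... | inj₂ (refl , 1≡0) = 0≢1 (sym 1≡0)

  open Size 𝔽 K K⇒N K-infinite-distinct size

  insert⁺ : ∀ {Q v} → insert Q (𝒯 s) v → insert Q ((K₀ ∶ 𝒫 (suc s)) ∪ 𝒳̄′ K s) v
  insert⁺ (inj₁ t)  = inj₁ (𝒯⇒∪ K⇒N s _ t)
  insert⁺ (inj₂ eq) = inj₂ eq
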